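{- Let $D=(V,A)$ be a loopless digraph, $b\in\mathbb{Z}_{++}^V$, and $w\in\mathbb{R}_+^A$. Define $g\colon\mathbb{Z}^V\to\mathbb{R}\cup\{+\infty\}$ by $$\operatorname{dom} g=\{x\in\mathbb{Z}_+^V : D \text{ has a } b\text{ -branching } B \text{ with } d_B^-+x\ge b\},$$ $$g(x)=\min\{w(B) : B \text{ is a } b\text{ -branching in } D,\ d_B^-+x\ge b\}\ \text{ for } x\in\operatorname{dom} g,\qquad g(x)=+\infty \text{ otherwise}.$$ Then $g$ is an $\mathrm{M}^\natural$-convex function.
   Context: For $B\subseteq A$, $d_B^-\in\mathbb{Z}^V$ is the indegree vector of $(V,B)$; $B[X]$ is the set of arcs of $B$ with both ends in $X$; $b(X)=\sum_{v\in X}b(v)$; $w(B)=\sum_{a\in B}w(a)$. An arc set $B\subseteq A$ is a $b$-branching if $d_B^-(v)\le b(v)$ for all $v\in V$ and $|B[X]|\le b(X)-1$ for all nonempty $X\subseteq V$. For $x\in\mathbb{Z}^V$, $\mathrm{supp}^+(x)=\{v: x(v)>0\}$, $\mathrm{supp}^-(x)=\{v : x(v)<0\}$, and $\chi_v$ is the unit vector of $v$. A function $f\colon\mathbb{Z}^V\to\mathbb{R}\cup\{+\infty\}$ is $\mathrm{M}^\natural$-convex if for all $x,y\in\mathbb{Z}^V$ and $u\in\mathrm{supp}^+(x-y)$, either $f(x)+f(y)\ge f(x-\chi_u)+f(y+\chi_u)$, or there exists $v\in\mathrm{supp}^-(x-y)$ with $f(x)+f(y)\ge f(x-\chi_u+\chi_v)+f(y+\chi_u-\chi_v)$.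 -}

module Defs where

open import Level using (Level; _⊔_) renaming (suc to lsuc)
open import Data.Bool using (Bool; true; false; if_then_else_; _∧_)
open import Data.Nat as ℕ using (ℕ; zero; suc)
open import Data.Integer as ℤ using (ℤ; +_)
open import Data.Fin as Fin using (Fin)
open import Data.Fin.Subset using (Subset; Nonempty)
open import Data.Vec using (lookup)
open import Data.Product using (Σ; ∃; ∃-syntax; _×_)
open import Data.Sum using (_⊎_)
open import Relation.Nullary using (¬_; ⌊_⌋)
open import Relation.Binary using (Rel; IsTotalOrder)
open import Relation.Binary.PropositionalEquality using (_≡_; _≢_)
open import Algebra.Bundles using (AbelianGroup)

sumℕ : (n : ℕ) → (Fin n → ℕ) → ℕ
sumℕ zero    f = 0
sumℕ (suc n) f = f Fin.zero ℕ.+ sumℕ n (λ i → f (Fin.suc i))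

[_] : Bool → ℕ
[ true ]  = 1
[ false ] = 0

-- A loopless digraph D = (V, A) with V = Fin n and A = Fin m
-- (parallel arcs allowed); arc a goes from tail a to head a.
record Digraph (n m : ℕ) : Set where
  field
    tail     : Fin m → Fin n
    head     : Fin m → Fin n
    loopless : ∀ a → tail a ≢ head a
open Digraph public

module _ {n m : ℕ} (D : Digraph n m) where

  indeg : Subset m → Fin n → ℕ
  indeg B v = sumℕ m (λ a → [ lookup B a ∧ ⌊ head D a Fin.≟ v ⌋ ])

  arcsIn : Subset m → Subset n → ℕ
  arcsIn B X = sumℕ m (λ a → [ lookup B a ∧ (lookup X (tail D a) ∧ lookup X (head D a)) ])

  bSum : (Fin n → ℕ) → Subset n → ℕ
  bSum b X = sumℕ n (λ v → if lookup X v then b v else 0)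

  -- B is a b-branching: d_B^- ≤ b and |B[X]| ≤ b(X) - 1 for nonempty X
  -- (written |B[X]| + 1 ≤ b(X), same thing over ℤ).
  IsBBranching : (Fin n → ℕ) → Subset m → Set
  IsBBranching b B =
    (∀ v → indeg B v ℕ.≤ b v) ×
    (∀ (X : Subset n) → Nonempty X → arcsIn B X ℕ.+ 1 ℕ.≤ bSum b X)

  Feasible : (Fin n → ℕ) → (Fin n → ℤ) → Subset m → Set
  Feasible b x B = IsBBranching b B × (∀ v → + b v ℤ.≤ + indeg B v ℤ.+ x v)

  InDom : (Fin n → ℕ) → (Fin n → ℤ) → Set
  InDom b x = (∀ v → + 0 ℤ.≤ x v) × ∃[ B ] Feasible b x B

-- Totally ordered abelian group (the weights live here; ℝ is an instance).
record OrderedAbelianGroup (c ℓ₁ ℓ₂ : Level) : Set (lsuc (c ⊔ ℓ₁ ⊔ ℓ₂)) where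
  field
    abelianGroup : AbelianGroup c ℓ₁
  open AbelianGroup abelianGroup public
  field
    _≤_          : Rel Carrier ℓ₂
    isTotalOrder : IsTotalOrder _≈_ _≤_
    ∙-monoˡ-≤    : ∀ {x y} z → x ≤ y → (x ∙ z) ≤ (y ∙ z)

module Weighted {c ℓ₁ ℓ₂} (G : OrderedAbelianGroup c ℓ₁ ℓ₂) where
  open OrderedAbelianGroup G

  sumG : (k : ℕ) → (Fin k → Carrier) → Carrier
  sumG zero    f = ε
  sumG (suc k) f = f Fin.zero ∙ sumG k (λ i → f (Fin.suc i))

  weight : {m : ℕ} → (Fin m → Carrier) → Subset m → Carrier
  weight {m} w B = sumG m (λ a → if lookup B a then w a else ε)

  data Ext : Set c where
    fin : Carrier → Ext
    ∞   : Ext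

  _⊕_ : Ext → Ext → Ext
  fin a ⊕ fin b = fin (a ∙ b)
  fin a ⊕ ∞     = ∞
  ∞     ⊕ _     = ∞

  data _≤∞_ : Ext → Ext → Set (c ⊔ ℓ₂) where
    fin≤fin : ∀ {a b} → a ≤ b → fin a ≤∞ fin b
    _≤∞∞    : ∀ e → e ≤∞ ∞

  χ : {n : ℕ} → Fin n → Fin n → ℤ
  χ u v = if ⌊ u Fin.≟ v ⌋ then + 1 else + 0

  MNatConvex : {n : ℕ} → ((Fin n → ℤ) → Ext) → Set (c ⊔ ℓ₂)
  MNatConvex {n} f =
    ∀ (x y : Fin n → ℤ) (u : Fin n) → y u ℤ.< x u →
      ((f (λ i → x i ℤ.- χ u i) ⊕ f (λ i → y i ℤ.+ χ u i)) ≤∞ (f x ⊕ f y))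
      ⊎ (∃[ v ] (x v ℤ.< y v ×
          ((f (λ i → (x i ℤ.- χ u i) ℤ.+ χ v i) ⊕ f (λ i → (y i ℤ.+ χ u i) ℤ.- χ v i))
             ≤∞ (f x ⊕ f y))))

  IsMinBranchingCost : {n m : ℕ} → Digraph n m → (Fin n → ℕ) → (Fin m → Carrier)
                       → ((Fin n → ℤ) → Ext) → Set (c ⊔ ℓ₂)
  IsMinBranchingCost D b w g =
    ∀ x → (¬ InDom D b x → g x ≡ ∞) ×
          (InDom D b x → ∃[ B ] (Feasible D b x B × g x ≡ fin (weight w B) ×
                                  (∀ B′ → Feasible D b x B′ → weight w B ≤ weight w B′)))

module Submission where

-- A set B with indegrees at most b is a b-branching iff every nonempty X on which the indegrees
-- equal b is entered by B. Let B₁, B₂ be optimal for x, y. If d₂(u) ≤ d₁(u), keep them. Otherwise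
-- one unit of indegree at u has to move from B₂ to B₁, and B₁ + B₂ is split anew with prescribed
-- indegrees. By Lovász's proof of Edmonds' disjoint branchings theorem a splitting exists as soon
-- as every set is entered by as many arcs as the two parts demand. If that fails, take a minimal
-- set X₀ ∋ u that no arc enters; B₂ has a vertex v in X₀ with d₂(v) < b(v), and moving one unit of
-- indegree at v back to B₂ repairs all demands.

-- Every new pair equals `B₁ + B₂` as a multiset of arcs, so the total weight is unchanged, and
-- minimality at the two new points gives the inequality. Two obstacles separate the splitting from
-- Edmonds' theorem. An arc of both branchings must stay in both, so only the symmetric difference
-- is distributed while the common arcs serve both parts for free. And the indegrees must be met
-- exactly: this works because each cover found has at most one new arc into each vertex, which
-- leaves all other arcs free to adjust the count there. The vertex v satisfies d₂(v) < d₁(v),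
-- whereas x(v) < y(v) may fail. In that case the same pair of branchings proves the first
-- alternative, since d₁(v) - 1 ≥ d₂(v) and x(v) ≥ y(v).

open import Defs
open import Data.Bool using (Bool; true; false; if_then_else_; _∧_; _∨_; not; _xor_)
open import Data.Bool.Properties using (∧-zeroʳ)
open import Data.Fin using (Fin; zero; suc)
open import Data.Fin.Properties using (suc-injective; any?; all?) renaming (_≟_ to _≟ᶠ_)
open import Data.Fin.Subset using (Subset; Nonempty; _∈_; _∉_; _⊆_; _∩_; _∪_; _-_; ⊤; ⊥; ∣_∣)
open import Data.Fin.Subset.Properties
open import Data.Integer as ℤ using (ℤ)
import Data.Integer.Properties as ℤₚ
import Data.Integer.Tactic.RingSolver as ℤ-Solver
open import Data.Nat using (ℕ; zero; suc; _+_; _∸_; _≤_; _<_; z≤n; s≤s; _≤?_; _<?_)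
open import Data.Nat.Induction using (Acc; acc; <-wellFounded)
open import Data.Nat.Properties hiding (suc-injective)
open import Data.Nat.Tactic.RingSolver using (solve-∀)
open import Data.Product using (∃; ∃-syntax; _×_; _,_; proj₁; proj₂)
open import Data.Sum using (_⊎_; inj₁; inj₂)
open import Data.Vec using (lookup; tabulate; []; _∷_; there)
open import Data.Vec.Properties using (lookup-zipWith; lookup∘tabulate; lookup⇒[]=; []=⇒lookup)
open import Function using (_∘_)
open import Relation.Binary using (IsTotalOrder)
open import Relation.Binary.PropositionalEquality
  using (_≡_; _≢_; refl; sym; trans; cong; cong₂; subst; subst₂; module ≡-Reasoning)
import Relation.Binary.Reasoning.Setoid as SetoidReasoning
open import Relation.Nullary using (¬_; Dec; yes; no; ⌊_⌋; contradiction; ¬?; _×-dec_)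
open import Relation.Nullary.Decidable using (map′; decidable-stable)

-- Finite sums

sum-cong : ∀ k {f g : Fin k → ℕ} → (∀ i → f i ≡ g i) → sumℕ k f ≡ sumℕ k g
sum-cong zero    f≡g = refl
sum-cong (suc k) f≡g = cong₂ _+_ (f≡g zero) (sum-cong k (f≡g ∘ suc))

sum-mono : ∀ k {f g : Fin k → ℕ} → (∀ i → f i ≤ g i) → sumℕ k f ≤ sumℕ k g
sum-mono zero    f≤g = z≤n
sum-mono (suc k) f≤g = +-mono-≤ (f≤g zero) (sum-mono k (f≤g ∘ suc))

sum-mono-< : ∀ k {f g : Fin k → ℕ} j → (∀ i → f i ≤ g i) → f j < g j → sumℕ k f < sumℕ k g
sum-mono-< (suc k) zero    f≤g f<g = +-mono-<-≤ f<g (sum-mono k (f≤g ∘ suc))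
sum-mono-< (suc k) (suc j) f≤g f<g = +-mono-≤-< (f≤g zero) (sum-mono-< k j (f≤g ∘ suc) f<g)

sum-0 : ∀ k → sumℕ k (λ _ → 0) ≡ 0
sum-0 zero    = refl
sum-0 (suc k) = sum-0 k

interchange : ∀ p q r s → (p + q) + (r + s) ≡ (p + r) + (q + s)
interchange = solve-∀

sum-+ : ∀ k (f g : Fin k → ℕ) → sumℕ k (λ i → f i + g i) ≡ sumℕ k f + sumℕ k g
sum-+ zero    f g = refl
sum-+ (suc k) f g = begin
  (f zero + g zero) + sumℕ k (λ i → f (suc i) + g (suc i))
    ≡⟨ cong ((f zero + g zero) +_) (sum-+ k (f ∘ suc) (g ∘ suc)) ⟩
  (f zero + g zero) + (sumℕ k (f ∘ suc) + sumℕ k (g ∘ suc))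
    ≡⟨ interchange (f zero) (g zero) _ _ ⟩
  (f zero + sumℕ k (f ∘ suc)) + (g zero + sumℕ k (g ∘ suc)) ∎
  where open ≡-Reasoning

sum-swap : ∀ k l (f : Fin k → Fin l → ℕ) →
           sumℕ k (λ i → sumℕ l (f i)) ≡ sumℕ l (λ j → sumℕ k (λ i → f i j))
sum-swap zero    l f = sym (sum-0 l)
sum-swap (suc k) l f = trans (cong (sumℕ l (f zero) +_) (sum-swap k l (f ∘ suc)))
                             (sym (sum-+ l (f zero) (λ j → sumℕ k (λ i → f (suc i) j))))

term≤sum : ∀ k (f : Fin k → ℕ) i → f i ≤ sumℕ k f
term≤sum (suc k) f zero    = m≤m+n (f zero) _
term≤sum (suc k) f (suc i) = ≤-trans (term≤sum k (f ∘ suc) i) (m≤n+m _ (f zero))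

sum-<⇒∃< : ∀ k (f g : Fin k → ℕ) → sumℕ k f < sumℕ k g → ∃[ i ] f i < g i
sum-<⇒∃< (suc k) f g lt with f zero <? g zero
... | yes f<g = zero , f<g
... | no  f≮g with sum-<⇒∃< k (f ∘ suc) (g ∘ suc)
                     (+-cancelˡ-< (f zero) _ _ (≤-trans lt (+-monoˡ-≤ _ (≮⇒≥ f≮g))))
...   | i , f<g = suc i , f<g

sum-≤-except : ∀ k (f g : Fin k → ℕ) c j → (∀ i → i ≢ j → f i ≤ g i) → f j ≤ c + g j →
               sumℕ k f ≤ c + sumℕ k g
sum-≤-except (suc k) f g c zero f≤g fj = begin
  f zero + sumℕ k (f ∘ suc)        ≤⟨ +-mono-≤ fj (sum-mono k (λ i → f≤g (suc i) λ ())) ⟩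
  (c + g zero) + sumℕ k (g ∘ suc)  ≡⟨ +-assoc c _ _ ⟩
  c + (g zero + sumℕ k (g ∘ suc))  ∎
  where open ≤-Reasoning
sum-≤-except (suc k) f g c (suc j) f≤g fj = begin
  f zero + sumℕ k (f ∘ suc)
    ≤⟨ +-mono-≤ (f≤g zero λ ())
         (sum-≤-except k (f ∘ suc) (g ∘ suc) c j (λ i i≢j → f≤g (suc i) (i≢j ∘ suc-injective)) fj) ⟩
  g zero + (c + sumℕ k (g ∘ suc))  ≡⟨ +-comm-middle (g zero) c _ ⟩
  c + (g zero + sumℕ k (g ∘ suc))  ∎
  where
  open ≤-Reasoning
  +-comm-middle : ∀ p q r → p + (q + r) ≡ q + (p + r)
  +-comm-middle = solve-∀

sum-pick : ∀ k (f : Fin k → ℕ) j → (∀ i → i ≢ j → f i ≡ 0) → sumℕ k f ≡ f j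
sum-pick k f j f≡0 = ≤-antisym
  (≤-trans (sum-≤-except k f (λ _ → 0) (f j) j (λ i i≢j → ≤-reflexive (f≡0 i i≢j)) (m≤m+n _ 0))
           (≤-reflexive (trans (cong (f j +_) (sum-0 k)) (+-identityʳ _))))
  (term≤sum k f j)

[]-mono : ∀ {p q} → (p ≡ true → q ≡ true) → [ p ] ≤ [ q ]
[]-mono {false} p⇒q = z≤n
[]-mono {true}  p⇒q rewrite p⇒q refl = ≤-refl

[]≥1⇒true : ∀ {p} → 1 ≤ [ p ] → p ≡ true
[]≥1⇒true {true} _ = refl

true∧ : ∀ {p q} → p ∧ q ≡ true → p ≡ true × q ≡ true
true∧ {true} eq = refl , eq

∧-true : ∀ {p q} → p ≡ true → q ≡ true → p ∧ q ≡ true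
∧-true refl refl = refl

not-true : ∀ {p} → not p ≡ true → p ≡ false
not-true {false} _ = refl

∉⇒lookup : ∀ {k} {X : Subset k} {v} → v ∉ X → lookup X v ≡ false
∉⇒lookup {X = X} {v} v∉X with lookup X v in eq
... | true  = contradiction (lookup⇒[]= v X eq) v∉X
... | false = refl

lookup⇒∉ : ∀ {k} {X : Subset k} {v} → lookup X v ≡ false → v ∉ X
lookup⇒∉ eq v∈X with trans (sym eq) ([]=⇒lookup v∈X)
... | ()

x∉p-x : ∀ {k} {p : Subset k} {x} → x ∉ p - x
x∉p-x {p = _ ∷ _} {zero}  ()
x∉p-x {p = _ ∷ p} {suc x} (there x∈) = x∉p-x {p = p} x∈

-- Cuts, and Lovász's argument

module Cuts {n m : ℕ} (D : Digraph n m) where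

  Arcs : Set
  Arcs = Fin m → Bool

  _⊑_ : Arcs → Arcs → Set
  P ⊑ Q = ∀ a → P a ≡ true → Q a ≡ true

  _⋎_ _∖_ : Arcs → Arcs → Arcs
  (P ⋎ Q) a = P a ∨ Q a
  (P ∖ Q) a = P a ∧ not (Q a)

  single : Fin m → Arcs
  single a x = ⌊ x ≟ᶠ a ⌋

  enters : Subset n → Arcs
  enters X a = not (lookup X (tail D a)) ∧ lookup X (head D a)

  ρ : Arcs → Subset n → ℕ
  ρ P X = sumℕ m (λ a → [ P a ∧ enters X a ])

  deg : Arcs → Fin n → ℕ
  deg P v = sumℕ m (λ a → [ P a ∧ ⌊ head D a ≟ᶠ v ⌋ ])

  enters⁺ : ∀ {X a} → tail D a ∉ X → head D a ∈ X → enters X a ≡ true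
  enters⁺ t∉X h∈X rewrite ∉⇒lookup t∉X = []=⇒lookup h∈X

  enters⁻ : ∀ {X a} → enters X a ≡ true → tail D a ∉ X × head D a ∈ X
  enters⁻ {X} eq with true∧ eq
  ... | nt , h = lookup⇒∉ (not-true nt) , lookup⇒[]= _ X h

  submodular-bits : ∀ p t h t′ h′ →
    [ p ∧ (not (t ∧ t′) ∧ (h ∧ h′)) ] + [ p ∧ (not (t ∨ t′) ∧ (h ∨ h′)) ]
      ≤ [ p ∧ (not t ∧ h) ] + [ p ∧ (not t′ ∧ h′) ]
  submodular-bits false _ _ _ _ = z≤n
  submodular-bits true true  true  true  true  = z≤n
  submodular-bits true true  true  true  false = z≤n
  submodular-bits true true  true  false true  = ≤-refl
  submodular-bits true true  true  false false = z≤n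
  submodular-bits true true  false true  true  = z≤n
  submodular-bits true true  false true  false = z≤n
  submodular-bits true true  false false true  = z≤n
  submodular-bits true true  false false false = z≤n
  submodular-bits true false true  true  true  = ≤-refl
  submodular-bits true false true  true  false = z≤n
  submodular-bits true false true  false true  = ≤-refl
  submodular-bits true false true  false false = ≤-refl
  submodular-bits true false false true  true  = z≤n
  submodular-bits true false false true  false = z≤n
  submodular-bits true false false false true  = ≤-refl
  submodular-bits true false false false false = z≤n

  ρ-submodular : ∀ P X Y → ρ P (X ∩ Y) + ρ P (X ∪ Y) ≤ ρ P X + ρ P Y
  ρ-submodular P X Y = subst₂ _≤_ (sum-+ m _ _) (sum-+ m _ _) (sum-mono m pointwise)
    where
    pointwise : ∀ a → [ P a ∧ enters (X ∩ Y) a ] + [ P a ∧ enters (X ∪ Y) a ]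
                      ≤ [ P a ∧ enters X a ] + [ P a ∧ enters Y a ]
    pointwise a
      rewrite lookup-zipWith _∧_ (tail D a) X Y | lookup-zipWith _∧_ (head D a) X Y
            | lookup-zipWith _∨_ (tail D a) X Y | lookup-zipWith _∨_ (head D a) X Y
      = submodular-bits (P a) (lookup X (tail D a)) (lookup X (head D a))
                        (lookup Y (tail D a)) (lookup Y (head D a))

  -- Hence the sets that `P` does not enter form a lattice. Uncrossing can therefore stay among the
  -- sets not entered by `C`, the only ones that raise demands.
  ρ-∩∪≡0 : ∀ P X Y → ρ P X ≡ 0 → ρ P Y ≡ 0 → ρ P (X ∩ Y) + ρ P (X ∪ Y) ≡ 0
  ρ-∩∪≡0 P X Y x0 y0 = n≤0⇒n≡0 (≤-trans (ρ-submodular P X Y) (≤-reflexive (cong₂ _+_ x0 y0)))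

  ρ-∩≡0 : ∀ P X Y → ρ P X ≡ 0 → ρ P Y ≡ 0 → ρ P (X ∩ Y) ≡ 0
  ρ-∩≡0 P X Y x0 y0 = m+n≡0⇒m≡0 (ρ P (X ∩ Y)) (ρ-∩∪≡0 P X Y x0 y0)

  ρ-∪≡0 : ∀ P X Y → ρ P X ≡ 0 → ρ P Y ≡ 0 → ρ P (X ∪ Y) ≡ 0
  ρ-∪≡0 P X Y x0 y0 = m+n≡0⇒n≡0 (ρ P (X ∩ Y)) (ρ-∩∪≡0 P X Y x0 y0)

  ρ-⊤ : ∀ P → ρ P ⊤ ≡ 0
  ρ-⊤ P = trans (sum-cong m pointwise) (sum-0 m)
    where
    pointwise : ∀ a → [ P a ∧ enters ⊤ a ] ≡ 0
    pointwise a rewrite []=⇒lookup (∈⊤ {x = tail D a}) | ∧-zeroʳ (P a) = refl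

  ∧-mono : ∀ {p q r} → (p ≡ true → q ≡ true) → [ p ∧ r ] ≤ [ q ∧ r ]
  ∧-mono {false} p⇒q = z≤n
  ∧-mono {true}  p⇒q rewrite p⇒q refl = ≤-refl

  ρ-mono : ∀ P Q X → P ⊑ Q → ρ P X ≤ ρ Q X
  ρ-mono P Q X P⊑Q = sum-mono m (λ a → ∧-mono (P⊑Q a))

  deg-mono : ∀ P Q v → P ⊑ Q → deg P v ≤ deg Q v
  deg-mono P Q v P⊑Q = sum-mono m (λ a → ∧-mono (P⊑Q a))

  ρ≥1 : ∀ P {X} a → P a ≡ true → tail D a ∉ X → head D a ∈ X → 1 ≤ ρ P X
  ρ≥1 P {X} a Pa t∉X h∈X = ≤-trans (≤-reflexive (sym (cong [_] bit))) (term≤sum m _ a)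
    where
    bit : P a ∧ enters X a ≡ true
    bit rewrite Pa = enters⁺ t∉X h∈X

  ρ≥1⇒∃ : ∀ P X → 1 ≤ ρ P X → ∃[ a ] (P a ≡ true × tail D a ∉ X × head D a ∈ X)
  ρ≥1⇒∃ P X 1≤ρ with sum-<⇒∃< m (λ _ → 0) _ (≤-trans (s≤s (≤-reflexive (sum-0 m))) 1≤ρ)
  ... | a , lt with true∧ ([]≥1⇒true lt)
  ...   | Pa , ent = a , Pa , enters⁻ ent

  -- Equivalently, every vertex of `S` is reachable along `P` from outside `S`.
  Covers : Arcs → Subset n → Set
  Covers P S = ∀ X → Nonempty X → X ⊆ S → 1 ≤ ρ P X

  Covers-mono : ∀ P Q {S} → P ⊑ Q → Covers P S → Covers Q S
  Covers-mono P Q P⊑Q cov X ne X⊆S = ≤-trans (cov X ne X⊆S) (ρ-mono P Q X P⊑Q)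

  ρ-remove-≤ : ∀ N a X → ρ N X ≤ 1 + ρ (N ∖ single a) X
  ρ-remove-≤ N a X = sum-≤-except m _ _ 1 a other bound
    where
    other : ∀ i → i ≢ a → [ N i ∧ enters X i ] ≤ [ (N i ∧ not ⌊ i ≟ᶠ a ⌋) ∧ enters X i ]
    other i i≢a with i ≟ᶠ a
    ... | yes i≡a = contradiction i≡a i≢a
    ... | no  _   with N i
    ...   | true  = ≤-refl
    ...   | false = z≤n
    bound : [ N a ∧ enters X a ] ≤ 1 + [ (N a ∧ not ⌊ a ≟ᶠ a ⌋) ∧ enters X a ]
    bound = ≤-trans ([]-mono {q = true} (λ _ → refl)) (m≤m+n 1 _)

  ρ-remove-non-entering : ∀ N a X → ¬ (tail D a ∉ X × head D a ∈ X) → ρ N X ≤ ρ (N ∖ single a) X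
  ρ-remove-non-entering N a X ¬ent = sum-mono m pointwise
    where
    pointwise : ∀ i → [ N i ∧ enters X i ] ≤ [ (N i ∧ not ⌊ i ≟ᶠ a ⌋) ∧ enters X i ]
    pointwise i with i ≟ᶠ a
    ... | yes refl = []-mono λ bit → contradiction (enters⁻ (proj₂ (true∧ {N i} bit))) ¬ent
    ... | no  _    with N i
    ...   | true  = ≤-refl
    ...   | false = z≤n

  -- C is available to both parts of the splitting, so only the sets X not entered by C raise
  -- demands: one arc of N for the part covering T if X ⊆ T, and another for S if X ⊆ S.
  record Coverable (N C : Arcs) (T S : Subset n) : Set where
    field
      demandT : ∀ X → Nonempty X → ρ C X ≡ 0 → X ⊆ T → 1 ≤ ρ N X
      demandS : ∀ X → Nonempty X → ρ C X ≡ 0 → X ⊆ S → 1 ≤ ρ N X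
      demand₂ : ∀ X → Nonempty X → ρ C X ≡ 0 → X ⊆ T → X ⊆ S → 2 ≤ ρ N X

  module _ {N C : Arcs} {T S : Subset n} (cov : Coverable N C T S) where
    open Coverable cov

    -- The obstruction to giving up an arc `a` of `N`: a set whose demand for `S` would lose its
    -- last arc. The bound `≤ 1` is enough, as `demandS` supplies the other inequality.
    Tight : Fin m → Subset n → Set
    Tight a Y = head D a ∈ Y × tail D a ∉ Y × Y ⊆ S × ρ C Y ≡ 0 × ρ N Y ≤ 1

    -- `T` is what remains to be reached. An arc coming from outside `T` reaches its head, which can
    -- then be dropped from `T`.
    Transferable : Fin m → Set
    Transferable a = N a ≡ true × tail D a ∉ T × head D a ∈ T × ¬ ∃ (Tight a)

    tight? : ∀ a → Dec (∃ (Tight a))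
    tight? a = anySubset? (λ Y → head D a ∈? Y ×-dec ¬? (tail D a ∈? Y) ×-dec Y ⊆? S
                                 ×-dec ρ C Y ≟ 0 ×-dec ρ N Y ≤? 1)

    -- Lovász's uncrossing: an arc entering X ∩ T from X ∖ T is transferable unless it enters
    -- some tight Y, and then X ∩ Y is a smaller set of the same kind.
    transferable-in : ∀ X → Acc _<_ ∣ X ∣ → ρ C X ≡ 0 → ρ N X < ρ N (X ∩ T) →
      (∀ Y → Y ⊆ S → ρ C Y ≡ 0 → Nonempty (X ∩ Y) → ρ N X ≤ ρ N (X ∪ Y)) → ρ C T ≡ 0 →
      ∃ Transferable
    transferable-in X (acc rs) CX lt below CT with sum-<⇒∃< m _ _ lt
    ... | a , a-lt = result (tight? a)
      where
      a-bit : N a ∧ enters (X ∩ T) a ≡ true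
      a-bit = []≥1⇒true (≤-trans (s≤s z≤n) a-lt)
      Na = proj₁ (true∧ {N a} a-bit)
      a-enters = enters⁻ {X ∩ T} (proj₂ (true∧ {N a} a-bit))
      h∈X = proj₁ (x∈p∩q⁻ X T (proj₂ a-enters))
      h∈T = proj₂ (x∈p∩q⁻ X T (proj₂ a-enters))

      -- `a` counts in the cut of `X ∩ T` but not in that of `X`.
      t∈X : tail D a ∈ X
      t∈X with tail D a ∈? X
      ... | yes t∈X = t∈X
      ... | no  t∉X = contradiction
        (≤-trans a-lt ([]-mono {q = N a ∧ enters X a} λ _ → cong₂ _∧_ Na (enters⁺ t∉X h∈X)))
        (<-irrefl refl)

      t∉T : tail D a ∉ T
      t∉T t∈T = proj₁ a-enters (x∈p∩q⁺ (t∈X , t∈T))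

      result : Dec (∃ (Tight a)) → ∃ Transferable
      result (no  ¬tight) = a , Na , t∉T , h∈T , ¬tight
      result (yes (Y , h∈Y , t∉Y , Y⊆S , CY , NY≤1)) =
        transferable-in (X ∩ Y) (rs smaller) (ρ-∩≡0 C X Y CX CY) gap below′ CT
        where
        smaller : ∣ X ∩ Y ∣ < ∣ X ∣
        smaller = p⊂q⇒∣p∣<∣q∣ (p∩q⊆p X Y , tail D a , t∈X , t∉Y ∘ proj₂ ∘ x∈p∩q⁻ X Y)
        h∈X∩Y : head D a ∈ X ∩ Y
        h∈X∩Y = x∈p∩q⁺ (h∈X , h∈Y)
        X∩Y≤1 : ρ N (X ∩ Y) ≤ 1
        X∩Y≤1 = +-cancelʳ-≤ (ρ N (X ∪ Y)) _ 1 (begin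
          ρ N (X ∩ Y) + ρ N (X ∪ Y)  ≤⟨ ρ-submodular N X Y ⟩
          ρ N X + ρ N Y              ≤⟨ +-mono-≤ (below Y Y⊆S CY (_ , h∈X∩Y)) NY≤1 ⟩
          ρ N (X ∪ Y) + 1            ≡⟨ +-comm _ 1 ⟩
          1 + ρ N (X ∪ Y)            ∎)
          where open ≤-Reasoning
        -- Two arcs enter the part of `X ∩ Y` in `T`, but at most one enters `X ∩ Y`; so some arc
        -- comes from `X ∩ Y` outside `T`, as the recursion requires.
        2≤ : 2 ≤ ρ N ((X ∩ Y) ∩ T)
        2≤ = demand₂ ((X ∩ Y) ∩ T) (_ , x∈p∩q⁺ (h∈X∩Y , h∈T)) (ρ-∩≡0 C (X ∩ Y) T (ρ-∩≡0 C X Y CX CY) CT)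
               (p∩q⊆q (X ∩ Y) T) (Y⊆S ∘ p∩q⊆q X Y ∘ p∩q⊆p (X ∩ Y) T)
        gap : ρ N (X ∩ Y) < ρ N ((X ∩ Y) ∩ T)
        gap = ≤-trans (s≤s X∩Y≤1) 2≤
        -- The hypothesis `below` lets one recursion treat both the start, where no arc enters `⊤`,
        -- and the later rounds, where the current set lies in `S`, has at most one entering arc,
        -- and `demandS` gives one for the union.
        below′ : ∀ Z → Z ⊆ S → ρ C Z ≡ 0 → Nonempty ((X ∩ Y) ∩ Z) →
                 ρ N (X ∩ Y) ≤ ρ N ((X ∩ Y) ∪ Z)
        below′ Z Z⊆S CZ (v , v∈) = ≤-trans X∩Y≤1
          (demandS _ (v , p⊆p∪q Z (p∩q⊆p (X ∩ Y) Z v∈)) (ρ-∪≡0 C (X ∩ Y) Z (ρ-∩≡0 C X Y CX CY) CZ)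
            ⊆S)
          where
          ⊆S : (X ∩ Y) ∪ Z ⊆ S
          ⊆S v∈∪ with x∈p∪q⁻ (X ∩ Y) Z v∈∪
          ... | inj₁ v∈X∩Y = Y⊆S (p∩q⊆q X Y v∈X∩Y)
          ... | inj₂ v∈Z   = Z⊆S v∈Z

    -- The search starts from `⊤`, which no arc enters, whereas `demandT` gives an arc entering `T`.
    transferable : Nonempty T → ρ C T ≡ 0 → ∃ Transferable
    transferable ne CT = transferable-in ⊤ (<-wellFounded _) (ρ-⊤ C)
      (subst₂ (λ p X → p < ρ N X) (sym (ρ-⊤ N)) (sym (∩-identityˡ T)) (demandT T ne CT (λ v∈T → v∈T)))
      (λ Y _ _ _ → ≤-trans (≤-reflexive (ρ-⊤ N)) z≤n) CT

    coverable-shrink : ∀ h → Coverable N C (T - h) S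
    coverable-shrink h = record
      { demandT = λ X ne CX X⊆ → demandT X ne CX (p─q⊆p T _ ∘ X⊆)
      ; demandS = demandS
      ; demand₂ = λ X ne CX X⊆ → demand₂ X ne CX (p─q⊆p T _ ∘ X⊆) }

    -- Sets inside `T - head D a` are not entered by `a` and lose nothing. Only a demand for `S` can
    -- lose `a`, and absence of tight sets leaves a second arc for it.
    coverable-transfer : ∀ {a} → Transferable a → Coverable (N ∖ single a) C (T - head D a) S
    coverable-transfer {a} (Na , t∉T , h∈T , ¬tight) = record
      { demandT = λ X ne CX X⊆ → ≤-trans (demandT X ne CX (p─q⊆p T _ ∘ X⊆)) (keep X X⊆)
      ; demandS = demandS′
      ; demand₂ = λ X ne CX X⊆ X⊆S → ≤-trans (demand₂ X ne CX (p─q⊆p T _ ∘ X⊆) X⊆S) (keep X X⊆) }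
      where
      keep : ∀ X → X ⊆ T - head D a → ρ N X ≤ ρ (N ∖ single a) X
      keep X X⊆ = ρ-remove-non-entering N a X (x∉p-x {p = T} ∘ X⊆ ∘ proj₂)
      demandS′ : ∀ X → Nonempty X → ρ C X ≡ 0 → X ⊆ S → 1 ≤ ρ (N ∖ single a) X
      demandS′ X ne CX X⊆S with head D a ∈? X ×-dec ¬? (tail D a ∈? X)
      ... | no  ¬ent = ≤-trans (demandS X ne CX X⊆S)
                         (ρ-remove-non-entering N a X λ (t∉X , h∈X) → ¬ent (h∈X , t∉X))
      ... | yes (h∈X , t∉X) with ρ N X ≤? 1
      ...   | yes ≤1 = contradiction (X , h∈X , t∉X , (λ {v} → X⊆S {v}) , CX , ≤1) ¬tight
      ...   | no  ≰1 = +-cancelˡ-≤ 1 1 _ (≤-trans (≰⇒> ≰1) (ρ-remove-≤ N a X))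

  -- `C` is added to both covers and never moved. The bound `deg≤` is what later makes room for
  -- prescribed indegrees.
  record Transfer (N C : Arcs) (T S : Subset n) : Set where
    field
      moved    : Arcs
      moved⊑   : moved ⊑ N
      deg≤     : ∀ v → deg moved v ≤ [ lookup T v ]
      coversT  : Covers (moved ⋎ C) T
      coversS  : Covers ((N ∖ moved) ⋎ C) S

  ⋎-inj₁ : ∀ P Q → P ⊑ (P ⋎ Q)
  ⋎-inj₁ P Q a Pa rewrite Pa = refl

  ⋎-inj₂ : ∀ P Q → Q ⊑ (P ⋎ Q)
  ⋎-inj₂ P Q a Qa rewrite Qa with P a
  ... | true  = refl
  ... | false = refl

  ∖⊑ : ∀ P Q → (P ∖ Q) ⊑ P
  ∖⊑ P Q a eq = proj₁ (true∧ {P a} eq)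

  deg-⋎-single : ∀ P a v → deg (P ⋎ single a) v ≤ [ ⌊ head D a ≟ᶠ v ⌋ ] + deg P v
  deg-⋎-single P a v = sum-≤-except m _ _ _ a other (bound (P a))
    where
    other : ∀ i → i ≢ a → [ (P i ∨ ⌊ i ≟ᶠ a ⌋) ∧ ⌊ head D i ≟ᶠ v ⌋ ] ≤ [ P i ∧ ⌊ head D i ≟ᶠ v ⌋ ]
    other i i≢a with i ≟ᶠ a
    ... | yes i≡a = contradiction i≡a i≢a
    ... | no  _   with P i
    ...   | true  = ≤-refl
    ...   | false = ≤-refl
    bound : ∀ p → [ (p ∨ ⌊ a ≟ᶠ a ⌋) ∧ ⌊ head D a ≟ᶠ v ⌋ ]
                  ≤ [ ⌊ head D a ≟ᶠ v ⌋ ] + [ p ∧ ⌊ head D a ≟ᶠ v ⌋ ]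
    bound p with p ∨ ⌊ a ≟ᶠ a ⌋
    ... | true  = m≤m+n _ _
    ... | false = z≤n

  coverable⇒Covers : ∀ {N C T S} Q → Coverable N C T S → N ⊑ Q → C ⊑ Q → Covers Q S
  coverable⇒Covers {N} {C} Q cov N⊑Q C⊑Q X ne X⊆S with ρ C X ≟ 0
  ... | yes CX  = ≤-trans (Coverable.demandS cov X ne CX X⊆S) (ρ-mono N Q X N⊑Q)
  ... | no  C≢0 = ≤-trans (n≢0⇒n>0 C≢0) (ρ-mono C Q X C⊑Q)

  -- A subset of `T` containing the head of `a` is entered by `a` itself, whose tail lies outside
  -- `T`.
  Covers-grow : ∀ P T a → P a ≡ true → tail D a ∉ T → head D a ∈ T →
                Covers P (T - head D a) → Covers P T
  Covers-grow P T a Pa t∉T h∈T cov X ne X⊆T with head D a ∈? X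
  ... | yes h∈X = ρ≥1 P a Pa (t∉T ∘ X⊆T) h∈X
  ... | no  h∉X = cov X ne λ v∈X → x∈p∧x≢y⇒x∈p-y (X⊆T v∈X) λ v≡h → h∉X (subst (_∈ X) v≡h v∈X)

  [lookup]-mono : ∀ {X Y : Subset n} v → X ⊆ Y → [ lookup X v ] ≤ [ lookup Y v ]
  [lookup]-mono {X} v X⊆Y = []-mono λ v∈X → []=⇒lookup (X⊆Y (lookup⇒[]= v X v∈X))

  -- Induction on `T`: the head of an arc entering `T` is dropped, and `Covers-grow` puts it back.
  -- An arc of `C` is preferred because it costs nothing; `transferable` is called once `C` does not
  -- enter `T`.
  transfer : ∀ {N C S} T → Acc _<_ ∣ T ∣ → Coverable N C T S → Transfer N C T S
  transfer {N} {C} {S} T (acc rs) cov with nonempty? T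
  ... | no  empty = record
    { moved = λ _ → false
    ; moved⊑ = λ _ ()
    ; deg≤ = λ v → ≤-trans (≤-reflexive (sum-0 m)) z≤n
    ; coversT = λ X (v , v∈X) X⊆T → contradiction (v , X⊆T v∈X) empty
    ; coversS = coverable⇒Covers ((N ∖ (λ _ → false)) ⋎ C) cov
                  (λ a Na → ⋎-inj₁ (N ∖ (λ _ → false)) C a (∧-true Na refl))
                  (⋎-inj₂ (N ∖ (λ _ → false)) C) }
  ... | yes ne with ρ C T ≟ 0
  ...   | no CT≢0 = step (ρ≥1⇒∃ C T (n≢0⇒n>0 CT≢0))
    where
    step : (∃[ a ] (C a ≡ true × tail D a ∉ T × head D a ∈ T)) → Transfer N C T S
    step (a , Ca , t∉T , h∈T) = record
      { moved = moved
      ; moved⊑ = moved⊑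
      ; deg≤ = λ v → ≤-trans (deg≤ v) ([lookup]-mono {T - head D a} v (p─q⊆p T _))
      ; coversT = Covers-grow (moved ⋎ C) T a (⋎-inj₂ moved C a Ca) t∉T h∈T coversT
      ; coversS = coversS }
      where
      open Transfer (transfer (T - head D a) (rs (x∈p⇒∣p-x∣<∣p∣ h∈T)) (coverable-shrink cov (head D a)))
  ...   | yes CT  = step (transferable cov ne CT)
    where
    step : ∃ (Transferable cov) → Transfer N C T S
    step (a , tr@(Na , t∉T , h∈T , _)) = record
      { moved = moved ⋎ single a
      ; moved⊑ = moved′⊑
      ; deg≤ = λ v → ≤-trans (deg-⋎-single moved a v) (≤-trans (+-monoʳ-≤ _ (deg≤ v)) (bits v))
      ; coversT = Covers-grow ((moved ⋎ single a) ⋎ C) T a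
                    (⋎-inj₁ (moved ⋎ single a) C a (⋎-inj₂ moved (single a) a single-refl)) t∉T h∈T
                    (Covers-mono (moved ⋎ C) _ moved⋎C⊑ coversT)
      ; coversS = Covers-mono (((N ∖ single a) ∖ moved) ⋎ C) _ rest⊑ coversS }
      where
      open Transfer (transfer (T - head D a) (rs (x∈p⇒∣p-x∣<∣p∣ h∈T)) (coverable-transfer cov tr))
      single-refl : single a a ≡ true
      single-refl with a ≟ᶠ a
      ... | yes _  = refl
      ... | no a≢a = contradiction refl a≢a
      moved′⊑ : (moved ⋎ single a) ⊑ N
      moved′⊑ x eq with moved x in mx | x ≟ᶠ a
      ... | true  | _        = ∖⊑ N (single a) x (moved⊑ x mx)
      ... | false | yes refl = Na
      moved⋎C⊑ : (moved ⋎ C) ⊑ ((moved ⋎ single a) ⋎ C)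
      moved⋎C⊑ x eq with moved x | C x | single a x
      ... | true  | _    | _     = refl
      ... | false | true | true  = refl
      ... | false | true | false = refl
      rest⊑ : (((N ∖ single a) ∖ moved) ⋎ C) ⊑ ((N ∖ (moved ⋎ single a)) ⋎ C)
      rest⊑ x eq with N x | moved x | single a x
      ... | true  | false | false = refl
      ... | true  | true  | true  = eq
      ... | true  | true  | false = eq
      ... | true  | false | true  = eq
      ... | false | _     | _     = eq
      bits : ∀ v → [ ⌊ head D a ≟ᶠ v ⌋ ] + [ lookup (T - head D a) v ] ≤ [ lookup T v ]
      bits v with head D a ≟ᶠ v
      ... | no  _    = [lookup]-mono {T - head D a} v (p─q⊆p T _)
      ... | yes refl rewrite ∉⇒lookup (x∉p-x {p = T} {head D a}) | []=⇒lookup h∈T = ≤-refl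

-- The exchange property of b-branchings

-- Choices at different heads are independent, and adding arcs of `Q` to `P` one by one passes
-- through every count at a head. The recursion decides arc by arc and charges a chosen arc to `k`
-- at its head.
interpolate-indegrees : ∀ {n} m (h : Fin m → Fin n) (P Q : Fin m → Bool) (k : Fin n → ℕ) →
  (∀ a → P a ≡ true → Q a ≡ true) →
  (∀ v → sumℕ m (λ a → [ P a ∧ ⌊ h a ≟ᶠ v ⌋ ]) ≤ k v) →
  (∀ v → k v ≤ sumℕ m (λ a → [ Q a ∧ ⌊ h a ≟ᶠ v ⌋ ])) →
  ∃[ R ] ((∀ a → P a ≡ true → lookup R a ≡ true) × (∀ a → lookup R a ≡ true → Q a ≡ true) ×
          (∀ v → sumℕ m (λ a → [ lookup R a ∧ ⌊ h a ≟ᶠ v ⌋ ]) ≡ k v))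
interpolate-indegrees zero    h P Q k P⊑Q P≤ ≤Q = [] , (λ ()) , (λ ()) , λ v → sym (n≤0⇒n≡0 (≤Q v))
interpolate-indegrees {n} (suc m) h P Q k P⊑Q P≤ ≤Q = choose (P zero) (Q zero) refl refl
  where
  d : (Fin m → Bool) → Fin n → ℕ
  d S v = sumℕ m (λ a → [ S a ∧ ⌊ h (suc a) ≟ᶠ v ⌋ ])

  bit : Fin n → ℕ
  bit v = [ ⌊ h zero ≟ᶠ v ⌋ ]

  Goal = ∃[ R ] ((∀ a → P a ≡ true → lookup R a ≡ true) × (∀ a → lookup R a ≡ true → Q a ≡ true) ×
                 (∀ v → sumℕ (suc m) (λ a → [ lookup R a ∧ ⌊ h a ≟ᶠ v ⌋ ]) ≡ k v))

  take : Q zero ≡ true → (∀ v → d (P ∘ suc) v + bit v ≤ k v) →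
         (∀ v → k v ≤ bit v + d (Q ∘ suc) v) → Goal
  take Q0 lo hi
    with interpolate-indegrees m (h ∘ suc) (P ∘ suc) (Q ∘ suc) (λ v → k v ∸ bit v) (P⊑Q ∘ suc)
           (λ v → m+n≤o⇒m≤o∸n _ (lo v)) (λ v → m≤n+o⇒m∸n≤o (k v) (bit v) (hi v))
  ... | R , P⊑R , R⊑Q , R≡ = true ∷ R
    , (λ { zero _ → refl ; (suc a) → P⊑R a })
    , (λ { zero _ → Q0 ; (suc a) → R⊑Q a })
    , λ v → trans (cong (bit v +_) (R≡ v)) (m+[n∸m]≡n (m+n≤o⇒n≤o (d (P ∘ suc) v) (lo v)))

  skip : P zero ≡ false → (∀ v → d (P ∘ suc) v ≤ k v) → (∀ v → k v ≤ d (Q ∘ suc) v) → Goal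
  skip P0 lo hi with interpolate-indegrees m (h ∘ suc) (P ∘ suc) (Q ∘ suc) k (P⊑Q ∘ suc) lo hi
  ... | R , P⊑R , R⊑Q , R≡ = false ∷ R
    , (λ { zero P0′ → trans (sym P0) P0′ ; (suc a) → P⊑R a })
    , (λ { zero () ; (suc a) → R⊑Q a })
    , R≡

  lo+ : ∀ v → [ P zero ∧ ⌊ h zero ≟ᶠ v ⌋ ] + d (P ∘ suc) v ≤ k v
  lo+ = P≤
  hi+ : ∀ v → k v ≤ [ Q zero ∧ ⌊ h zero ≟ᶠ v ⌋ ] + d (Q ∘ suc) v
  hi+ = ≤Q

  lo- : ∀ v → d (P ∘ suc) v ≤ k v
  lo- v = m+n≤o⇒n≤o [ P zero ∧ ⌊ h zero ≟ᶠ v ⌋ ] (lo+ v)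

  choose : ∀ p q → P zero ≡ p → Q zero ≡ q → Goal
  choose true q P0 Q0 = take (P⊑Q zero P0)
    (λ v → subst (_≤ k v) (+-comm (bit v) _)
             (subst (λ p → [ p ∧ ⌊ h zero ≟ᶠ v ⌋ ] + d (P ∘ suc) v ≤ k v) P0 (lo+ v)))
    (λ v → subst (λ q → k v ≤ [ q ∧ ⌊ h zero ≟ᶠ v ⌋ ] + d (Q ∘ suc) v) (P⊑Q zero P0) (hi+ v))
  choose false false P0 Q0 = skip P0 lo-
    (λ v → subst (λ q → k v ≤ [ q ∧ ⌊ h zero ≟ᶠ v ⌋ ] + d (Q ∘ suc) v) Q0 (hi+ v))
  -- An optional arc is taken exactly when the remaining forced arcs leave `k` unfilled at its head.
  -- Otherwise those forced arcs, which also lie in `Q`, already show that the rest of `Q` reaches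
  -- `k` there.
  choose false true P0 Q0 with d (P ∘ suc) (h zero) <? k (h zero)
  ... | yes lt = take Q0 lo (λ v → subst (λ q → k v ≤ [ q ∧ ⌊ h zero ≟ᶠ v ⌋ ] + d (Q ∘ suc) v) Q0 (hi+ v))
    where
    lo : ∀ v → d (P ∘ suc) v + bit v ≤ k v
    lo v with h zero ≟ᶠ v
    ... | yes refl = subst (_≤ k v) (+-comm 1 _) lt
    ... | no  _    = subst (_≤ k v) (sym (+-identityʳ _)) (lo- v)
  ... | no  ≮  = skip P0 lo- hi
    where
    mono : ∀ v → d (P ∘ suc) v ≤ d (Q ∘ suc) v
    mono v = sum-mono m λ a → []-mono λ eq →
      ∧-true (P⊑Q (suc a) (proj₁ (true∧ eq))) (proj₂ (true∧ {P (suc a)} eq))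
    hi : ∀ v → k v ≤ d (Q ∘ suc) v
    hi v with h zero ≟ᶠ v | subst (λ q → k v ≤ [ q ∧ ⌊ h zero ≟ᶠ v ⌋ ] + d (Q ∘ suc) v) Q0 (hi+ v)
    ... | yes refl | _  = ≤-trans (≮⇒≥ ≮) (mono v)
    ... | no  _    | le = le

-- b-branchings as covers of the vertices of full indegree

module Exchange {n m : ℕ} (D : Digraph n m) (b : Fin n → ℕ) where
  open Cuts D

  -- Double counting: an arc with head in `X` either has its tail in `X` too or enters `X`.
  bSum-indeg : ∀ B X → bSum D (indeg D B) X ≡ arcsIn D B X + ρ (lookup B) X
  bSum-indeg B X = begin
    sumℕ n (λ v → if lookup X v then indeg D B v else 0)
      ≡⟨ sum-cong n (λ v → if-sum (lookup X v) _) ⟩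
    sumℕ n (λ v → sumℕ m (λ a → if lookup X v then [ lookup B a ∧ ⌊ head D a ≟ᶠ v ⌋ ] else 0))
      ≡⟨ sum-swap n m _ ⟩
    sumℕ m (λ a → sumℕ n (λ v → if lookup X v then [ lookup B a ∧ ⌊ head D a ≟ᶠ v ⌋ ] else 0))
      ≡⟨ sum-cong m (λ a → trans (sum-pick n _ (head D a) (off-head a)) (at-head a)) ⟩
    sumℕ m (λ a → [ lookup B a ∧ (lookup X (tail D a) ∧ lookup X (head D a)) ]
                + [ lookup B a ∧ enters X a ])
      ≡⟨ sum-+ m _ _ ⟩
    arcsIn D B X + ρ (lookup B) X ∎
    where
    open ≡-Reasoning
    if-sum : ∀ x (f : Fin m → ℕ) → (if x then sumℕ m f else 0) ≡ sumℕ m (λ a → if x then f a else 0)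
    if-sum true  f = refl
    if-sum false f = sym (sum-0 m)
    off-head : ∀ a v → v ≢ head D a →
               (if lookup X v then [ lookup B a ∧ ⌊ head D a ≟ᶠ v ⌋ ] else 0) ≡ 0
    off-head a v v≢h with lookup X v | head D a ≟ᶠ v
    ... | false | _       = refl
    ... | true  | yes h≡v = contradiction (sym h≡v) v≢h
    ... | true  | no  _   rewrite ∧-zeroʳ (lookup B a) = refl
    bits : ∀ p t h → (if h then [ p ∧ true ] else 0) ≡ [ p ∧ (t ∧ h) ] + [ p ∧ (not t ∧ h) ]
    bits true  true  true  = refl
    bits true  true  false = refl
    bits true  false true  = refl
    bits true  false false = refl
    bits false true  true  = refl
    bits false true  false = refl
    bits false false true  = refl
    bits false false false = refl
    at-head : ∀ a → (if lookup X (head D a) then [ lookup B a ∧ ⌊ head D a ≟ᶠ head D a ⌋ ] else 0)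
              ≡ [ lookup B a ∧ (lookup X (tail D a) ∧ lookup X (head D a)) ] + [ lookup B a ∧ enters X a ]
    at-head a with head D a ≟ᶠ head D a
    ... | yes _  = bits (lookup B a) (lookup X (tail D a)) (lookup X (head D a))
    ... | no h≢h = contradiction refl h≢h

  masked-mono : ∀ {f g : Fin n → ℕ} X → (∀ v → v ∈ X → f v ≤ g v) → ∀ v →
                (if lookup X v then f v else 0) ≤ (if lookup X v then g v else 0)
  masked-mono X f≤g v with lookup X v in eq
  ... | true  = f≤g v (lookup⇒[]= v X eq)
  ... | false = z≤n

  bSum-mono : ∀ {f g : Fin n → ℕ} X → (∀ v → v ∈ X → f v ≤ g v) → bSum D f X ≤ bSum D g X
  bSum-mono X f≤g = sum-mono n (masked-mono X f≤g)

  bSum-mono-< : ∀ {f g : Fin n → ℕ} X u → (∀ v → v ∈ X → f v ≤ g v) → u ∈ X → f u < g u →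
                bSum D f X < bSum D g X
  bSum-mono-< {f} {g} X u f≤g u∈X fu<gu = sum-mono-< n u (masked-mono X f≤g)
    (subst (λ x → (if x then f u else 0) < (if x then g u else 0)) (sym ([]=⇒lookup u∈X)) fu<gu)

  full : (Fin n → ℕ) → Subset n
  full k = tabulate (λ v → ⌊ k v ≟ b v ⌋)

  ∈full⁺ : ∀ {k v} → k v ≡ b v → v ∈ full k
  ∈full⁺ {k} {v} eq = lookup⇒[]= v _ (trans (lookup∘tabulate _ v) is-yes)
    where
    is-yes : ⌊ k v ≟ b v ⌋ ≡ true
    is-yes with k v ≟ b v
    ... | yes _ = refl
    ... | no ne = contradiction eq ne

  ∈full⁻ : ∀ {k v} → v ∈ full k → k v ≡ b v
  ∈full⁻ {k} {v} v∈ with k v ≟ b v | trans (sym (lookup∘tabulate (λ v → ⌊ k v ≟ b v ⌋) v)) ([]=⇒lookup v∈)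
  ... | yes eq | _ = eq

  -- Where all indegrees equal `b`, the value `bSum D b X` counts the arcs with head in `X`; the
  -- unit by which `arcsIn` must fall short of it is an entering arc.
  branching⇒covers : ∀ {B} → IsBBranching D b B → Covers (lookup B) (full (indeg D B))
  branching⇒covers {B} (_ , sparse) X ne X⊆ = +-cancelˡ-≤ (arcsIn D B X) 1 _ (begin
    arcsIn D B X + 1                ≤⟨ sparse X ne ⟩
    bSum D b X                      ≤⟨ bSum-mono X (λ v v∈X → ≤-reflexive (sym (∈full⁻ {indeg D B} (X⊆ v∈X)))) ⟩
    bSum D (indeg D B) X            ≡⟨ bSum-indeg B X ⟩
    arcsIn D B X + ρ (lookup B) X   ∎)
    where open ≤-Reasoning

  -- The unit to spare comes from a vertex of `X` with indegree below `b`, if there is one, and from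
  -- an entering arc otherwise.
  covers⇒branching : ∀ {B} → (∀ v → indeg D B v ≤ b v) → Covers (lookup B) (full (indeg D B)) →
                     IsBBranching D b B
  covers⇒branching {B} indeg≤b cov = indeg≤b , sparse
    where
    open ≤-Reasoning
    sparse : ∀ X → Nonempty X → arcsIn D B X + 1 ≤ bSum D b X
    sparse X ne with any? (λ v → v ∈? X ×-dec indeg D B v <? b v)
    ... | yes (v , v∈X , lt) = begin
      arcsIn D B X + 1                       ≡⟨ +-comm _ 1 ⟩
      1 + arcsIn D B X                       ≤⟨ s≤s (m≤m+n _ _) ⟩
      1 + (arcsIn D B X + ρ (lookup B) X)    ≡⟨ cong suc (bSum-indeg B X) ⟨
      1 + bSum D (indeg D B) X               ≤⟨ bSum-mono-< X v (λ w _ → indeg≤b w) v∈X lt ⟩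
      bSum D b X                             ∎
    ... | no  none = begin
      arcsIn D B X + 1                       ≤⟨ +-monoʳ-≤ _ (cov X ne X⊆) ⟩
      arcsIn D B X + ρ (lookup B) X          ≡⟨ bSum-indeg B X ⟨
      bSum D (indeg D B) X                   ≤⟨ bSum-mono X (λ v _ → indeg≤b v) ⟩
      bSum D b X                             ∎
      where
      X⊆ : X ⊆ full (indeg D B)
      X⊆ {v} v∈X = ∈full⁺ {indeg D B} (≤-antisym (indeg≤b v) (≮⇒≥ λ lt → none (v , v∈X , lt)))

  -- The common arcs have to stay in both parts, so only the symmetric difference is distributed.
  common union symDiff : Subset m → Subset m → Arcs
  common  B₁ B₂ a = lookup B₁ a ∧ lookup B₂ a
  union   B₁ B₂ a = lookup B₁ a ∨ lookup B₂ a
  symDiff B₁ B₂ a = lookup B₁ a xor lookup B₂ a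

  -- Equality of `P + Q` and `P′ + Q′` as multisets; it preserves every total over arcs, be it an
  -- indegree, a cut or a weight.
  Balanced : Arcs → Arcs → Arcs → Arcs → Set
  Balanced P Q P′ Q′ = ∀ a → [ P a ] + [ Q a ] ≡ [ P′ a ] + [ Q′ a ]

  balanced-∧ : ∀ {p q p′ q′} r → [ p ] + [ q ] ≡ [ p′ ] + [ q′ ] →
               [ p ∧ r ] + [ q ∧ r ] ≡ [ p′ ∧ r ] + [ q′ ∧ r ]
  balanced-∧ {p} {q} {p′} {q′} true  eq = trans (bits p q) (trans eq (sym (bits p′ q′)))
    where
    bits : ∀ p q → [ p ∧ true ] + [ q ∧ true ] ≡ [ p ] + [ q ]
    bits true  true  = refl
    bits true  false = refl
    bits false true  = refl
    bits false false = refl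
  balanced-∧ {p} {q} {p′} {q′} false eq = trans (bits p q) (sym (bits p′ q′))
    where
    bits : ∀ p q → [ p ∧ false ] + [ q ∧ false ] ≡ 0
    bits true  true  = refl
    bits true  false = refl
    bits false true  = refl
    bits false false = refl

  balanced-sum : ∀ {P Q P′ Q′} → Balanced P Q P′ Q′ → ∀ (r : Fin m → Bool) →
    sumℕ m (λ a → [ P a ∧ r a ]) + sumℕ m (λ a → [ Q a ∧ r a ])
      ≡ sumℕ m (λ a → [ P′ a ∧ r a ]) + sumℕ m (λ a → [ Q′ a ∧ r a ])
  balanced-sum {P} {Q} {P′} {Q′} bal r = trans (sym (sum-+ m _ _)) (trans
    (sum-cong m (λ a → balanced-∧ {P a} {Q a} {P′ a} {Q′ a} (r a) (bal a))) (sum-+ m _ _))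

  -- An empty partner, with which an identity between three arc sets also takes the form `Balanced`.
  none : Arcs
  none _ = false

  common-union-balanced : ∀ B₁ B₂ → Balanced (lookup B₁) (lookup B₂) (union B₁ B₂) (common B₁ B₂)
  common-union-balanced B₁ B₂ a with lookup B₁ a | lookup B₂ a
  ... | true  | true  = refl
  ... | true  | false = refl
  ... | false | true  = refl
  ... | false | false = refl

  symDiff-common-balanced : ∀ B₁ B₂ → Balanced (symDiff B₁ B₂) (common B₁ B₂) (union B₁ B₂) none
  symDiff-common-balanced B₁ B₂ a with lookup B₁ a | lookup B₂ a
  ... | true  | true  = refl
  ... | true  | false = refl
  ... | false | true  = refl
  ... | false | false = refl

  -- As multisets, the two branchings sum to union plus common arcs, and the union is symmetric
  -- difference plus common arcs; the common arcs contribute nothing at `X`.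
  ρ-symDiff : ∀ B₁ B₂ X → ρ (common B₁ B₂) X ≡ 0 →
              ρ (lookup B₁) X + ρ (lookup B₂) X ≡ ρ (symDiff B₁ B₂) X
  ρ-symDiff B₁ B₂ X C0 = begin
    ρ (lookup B₁) X + ρ (lookup B₂) X
      ≡⟨ balanced-sum {lookup B₁} {lookup B₂} {union B₁ B₂} {common B₁ B₂}
           (common-union-balanced B₁ B₂) (enters X) ⟩
    ρ (union B₁ B₂) X + ρ (common B₁ B₂) X
      ≡⟨ cong (ρ (union B₁ B₂) X +_) (trans C0 (sym (sum-0 m))) ⟩
    ρ (union B₁ B₂) X + ρ none X
      ≡⟨ balanced-sum {symDiff B₁ B₂} {common B₁ B₂} {union B₁ B₂} {none}
           (symDiff-common-balanced B₁ B₂) (enters X) ⟨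
    ρ (symDiff B₁ B₂) X + ρ (common B₁ B₂) X
      ≡⟨ cong (ρ (symDiff B₁ B₂) X +_) C0 ⟩
    ρ (symDiff B₁ B₂) X + 0
      ≡⟨ +-identityʳ _ ⟩
    ρ (symDiff B₁ B₂) X ∎
    where open ≡-Reasoning

  -- Splitting with prescribed indegrees

  record Resplit (B₁ B₂ : Subset m) (k₁ k₂ : Fin n → ℕ) : Set where
    field
      B₁′ B₂′    : Subset m
      branching₁ : IsBBranching D b B₁′
      branching₂ : IsBBranching D b B₂′
      indeg₁     : ∀ v → indeg D B₁′ v ≡ k₁ v
      indeg₂     : ∀ v → indeg D B₂′ v ≡ k₂ v
      balanced   : Balanced (lookup B₁′) (lookup B₂′) (lookup B₁) (lookup B₂)

  -- Two transfers give disjoint sparse sets `M₁` and `M₂` in `F` that, together with `C`, cover the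
  -- two full sets. Any first part between `M₁ ⋎ C` and `U ∖ M₂` then keeps both covers, so it
  -- remains to hit `k₁` in this interval; the indegrees `k₂` follow from `total`.
  module Resplitting (B₁ B₂ : Subset m) (k₁ k₂ : Fin n → ℕ)
    (total : ∀ v → k₁ v + k₂ v ≡ indeg D B₁ v + indeg D B₂ v)
    (k₁≤b : ∀ v → k₁ v ≤ b v) (k₂≤b : ∀ v → k₂ v ≤ b v)
    (C≤k₁ : ∀ v → deg (common B₁ B₂) v ≤ k₁ v) (C≤k₂ : ∀ v → deg (common B₁ B₂) v ≤ k₂ v)
    (cov : Coverable (symDiff B₁ B₂) (common B₁ B₂) (full k₁) (full k₂)) where

    C = common B₁ B₂
    U = union B₁ B₂
    F = symDiff B₁ B₂

    transfer₁ : Transfer F C (full k₁) (full k₂)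
    transfer₁ = transfer (full k₁) (<-wellFounded _) cov
    open Transfer transfer₁ using () renaming
      (moved to M₁; moved⊑ to M₁⊑F; deg≤ to degM₁≤; coversT to covers₁; coversS to covers-rest)

    ρ-⋎ : ∀ P Q X → ρ Q X ≡ 0 → ρ (P ⋎ Q) X ≤ ρ P X
    ρ-⋎ P Q X Q0 = subst (ρ (P ⋎ Q) X ≤_) (trans (cong (ρ P X +_) Q0) (+-identityʳ _))
      (subst (ρ (P ⋎ Q) X ≤_) (sum-+ m _ _) (sum-mono m (λ a → bits (P a) (Q a) (enters X a))))
      where
      bits : ∀ p q r → [ (p ∨ q) ∧ r ] ≤ [ p ∧ r ] + [ q ∧ r ]
      bits true  q r = m≤m+n _ _
      bits false q r = ≤-refl

    -- The second transfer thins F ∖ M₁ to a cover with at most one arc into each vertex; the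
    -- remaining arcs are then free for adjusting the indegrees.
    cov₂ : Coverable (F ∖ M₁) C (full k₂) ⊥
    cov₂ = record
      { demandT = λ X ne C0 X⊆ → ≤-trans (covers-rest X ne X⊆) (ρ-⋎ (F ∖ M₁) C X C0)
      ; demandS = λ X (v , v∈X) _ X⊆⊥ → contradiction (X⊆⊥ v∈X) ∉⊥
      ; demand₂ = λ X (v , v∈X) _ _ X⊆⊥ → contradiction (X⊆⊥ v∈X) ∉⊥ }

    transfer₂ : Transfer (F ∖ M₁) C (full k₂) ⊥
    transfer₂ = transfer (full k₂) (<-wellFounded _) cov₂
    open Transfer transfer₂ using () renaming
      (moved to M₂; moved⊑ to M₂⊑F∖M₁; deg≤ to degM₂≤; coversT to covers₂)

    M₂⊑F : M₂ ⊑ F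
    M₂⊑F a eq = ∖⊑ F M₁ a (M₂⊑F∖M₁ a eq)

    U-C-total : ∀ v → deg U v + deg C v ≡ k₁ v + k₂ v
    U-C-total v = trans (sym (balanced-sum (common-union-balanced B₁ B₂) (λ a → ⌊ head D a ≟ᶠ v ⌋)))
                        (sym (total v))

    M-C-balanced : ∀ {M} → M ⊑ F → Balanced M C (M ⋎ C) none
    M-C-balanced {M} M⊑F a with M a in eq
    ... | false = +-comm 0 [ C a ]
    ... | true  with lookup B₁ a | lookup B₂ a | M⊑F a eq
    ...   | true  | false | _ = refl
    ...   | false | true  | _ = refl

    M⋎C⊑U : ∀ {M} → M ⊑ F → (M ⋎ C) ⊑ U
    M⋎C⊑U {M} M⊑F a eq with M a in Ma | lookup B₁ a | lookup B₂ a | M⊑F a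
    ... | _     | true  | _     | _ = refl
    ... | _     | false | true  | _ = refl
    ... | true  | false | false | f = f refl
    ... | false | false | false | _ = eq

    deg-M-C : ∀ {M} v → M ⊑ F → deg M v + deg C v ≡ deg (M ⋎ C) v
    deg-M-C {M} v M⊑F = trans (balanced-sum (M-C-balanced M⊑F) (λ a → ⌊ head D a ≟ᶠ v ⌋))
                          (trans (cong (deg (M ⋎ C) v +_) (sum-0 m)) (+-identityʳ _))

    -- At a vertex where k = b = deg C every arc of U is common, so M has no arc there.
    room : ∀ {M} k v → M ⊑ F → deg M v ≤ [ lookup (full k) v ] → k v ≤ b v → deg C v ≤ k v →
           deg M v + deg C v ≤ k v
    room {M} k v M⊑F degM≤ k≤b C≤k with k v ≟ b v | deg C v <? b v
    ... | no  k≢b | _ = ≤-trans (+-monoˡ-≤ _ degM≤0) C≤k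
      where
      degM≤0 : deg M v ≤ 0
      degM≤0 = subst (λ x → deg M v ≤ [ x ]) (∉⇒lookup (k≢b ∘ ∈full⁻ {k})) degM≤
    ... | yes k≡b | yes C<b = begin
      deg M v + deg C v  ≤⟨ +-monoˡ-≤ _ (≤-trans degM≤ ([]-mono {q = true} λ _ → refl)) ⟩
      1 + deg C v        ≤⟨ C<b ⟩
      b v                ≡⟨ k≡b ⟨
      k v                ∎
      where open ≤-Reasoning
    ... | yes k≡b | no  C≮b = begin
      deg M v + deg C v  ≡⟨ deg-M-C v M⊑F ⟩
      deg (M ⋎ C) v      ≤⟨ deg-mono (M ⋎ C) U v (M⋎C⊑U M⊑F) ⟩
      deg U v            ≤⟨ +-cancelʳ-≤ (deg C v) _ (b v) U+C≤ ⟩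
      b v                ≡⟨ k≡b ⟨
      k v                ∎
      where
      open ≤-Reasoning
      U+C≤ : deg U v + deg C v ≤ b v + deg C v
      U+C≤ = ≤-trans (≤-reflexive (U-C-total v))
               (+-mono-≤ (k₁≤b v) (≤-trans (k₂≤b v) (≮⇒≥ C≮b)))

    -- `U` and `C` have total indegree `k₁ + k₂`, of which `M₂` and `C` take at most `k₂` by `room`.
    upper : ∀ v → k₁ v ≤ deg (U ∖ M₂) v
    upper v = +-cancelʳ-≤ (deg M₂ v + deg C v) (k₁ v) _ (begin
      k₁ v + (deg M₂ v + deg C v)
        ≤⟨ +-monoʳ-≤ (k₁ v) (room k₂ v M₂⊑F (degM₂≤ v) (k₂≤b v) (C≤k₂ v)) ⟩
      k₁ v + k₂ v
        ≡⟨ U-C-total v ⟨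
      deg U v + deg C v
        ≡⟨ cong (_+ deg C v) U≡ ⟩
      (deg (U ∖ M₂) v + deg M₂ v) + deg C v
        ≡⟨ +-assoc (deg (U ∖ M₂) v) (deg M₂ v) (deg C v) ⟩
      deg (U ∖ M₂) v + (deg M₂ v + deg C v) ∎)
      where
      open ≤-Reasoning
      bal : Balanced (U ∖ M₂) M₂ U none
      bal a with M₂ a in eq | U a | M⋎C⊑U M₂⊑F a
      ... | true  | true  | _ = refl
      ... | true  | false | f = contradiction (f refl) λ ()
      ... | false | true  | _ = refl
      ... | false | false | _ = refl
      U≡ : deg U v ≡ deg (U ∖ M₂) v + deg M₂ v
      U≡ = sym (trans (balanced-sum bal (λ a → ⌊ head D a ≟ᶠ v ⌋))
                      (trans (cong (deg U v +_) (sum-0 m)) (+-identityʳ _)))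

    M₁⋎C⊑U∖M₂ : (M₁ ⋎ C) ⊑ (U ∖ M₂)
    M₁⋎C⊑U∖M₂ a eq with M₂ a in m₂
    ... | false = ∧-true (M⋎C⊑U M₁⊑F a eq) refl
    ... | true  with M₁ a | lookup B₁ a | lookup B₂ a | M₂⊑F∖M₁ a m₂ | eq
    ...   | true  | true  | true  | () | _
    ...   | true  | true  | false | () | _
    ...   | true  | false | true  | () | _
    ...   | true  | false | false | () | _

    resplit : Resplit B₁ B₂ k₁ k₂
    resplit with interpolate-indegrees m (head D) (M₁ ⋎ C) (U ∖ M₂) k₁ M₁⋎C⊑U∖M₂
                   (λ v → subst (_≤ k₁ v) (deg-M-C v M₁⊑F) (room k₁ v M₁⊑F (degM₁≤ v) (k₁≤b v) (C≤k₁ v)))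
                   upper
    ... | R , lo , hi , degR = record
      { B₁′ = R
      ; B₂′ = R′
      ; branching₁ = covers⇒branching {R} (λ v → subst (_≤ b v) (sym (degR v)) (k₁≤b v))
          (λ X ne X⊆ → ≤-trans (covers₁ X ne (full-cong degR ∘ X⊆)) (ρ-mono (M₁ ⋎ C) (lookup R) X lo))
      ; branching₂ = covers⇒branching {R′} (λ v → subst (_≤ b v) (sym (degR′ v)) (k₂≤b v))
          (λ X ne X⊆ → ≤-trans (covers₂ X ne (full-cong degR′ ∘ X⊆)) (ρ-mono (M₂ ⋎ C) (lookup R′) X lo′))
      ; indeg₁ = degR
      ; indeg₂ = degR′
      ; balanced = bal }
      where
      -- `R` contains all of `C`, so its complement in `U` misses the common arcs, and they are put
      -- back.
      R′ : Subset m
      R′ = tabulate (λ a → (U a ∧ not (lookup R a)) ∨ C a)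
      full-cong : ∀ {k l} → (∀ v → k v ≡ l v) → full k ⊆ full l
      full-cong {k} {l} k≡l {v} v∈ = ∈full⁺ {l} (trans (sym (k≡l v)) (∈full⁻ {k} v∈))
      C⊑R : C ⊑ lookup R
      C⊑R a Ca = lo a (⋎-inj₂ M₁ C a Ca)
      R⊑U : lookup R ⊑ U
      R⊑U a Ra = ∖⊑ U M₂ a (hi a Ra)
      bal : Balanced (lookup R) (lookup R′) (lookup B₁) (lookup B₂)
      bal a rewrite lookup∘tabulate (λ a → (U a ∧ not (lookup R a)) ∨ C a) a
        with lookup B₁ a | lookup B₂ a | lookup R a | C⊑R a | R⊑U a
      ... | true  | true  | true  | _   | _   = refl
      ... | true  | true  | false | C⊑R | _   = contradiction (C⊑R refl) λ ()
      ... | true  | false | true  | _   | _   = refl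
      ... | true  | false | false | _   | _   = refl
      ... | false | true  | true  | _   | _   = refl
      ... | false | true  | false | _   | _   = refl
      ... | false | false | true  | _   | R⊑U = contradiction (R⊑U refl) λ ()
      ... | false | false | false | _   | _   = refl
      degR′ : ∀ v → indeg D R′ v ≡ k₂ v
      degR′ v = +-cancelˡ-≡ (k₁ v) _ _ (begin
        k₁ v + deg (lookup R′) v                ≡⟨ cong (_+ deg (lookup R′) v) (degR v) ⟨
        deg (lookup R) v + deg (lookup R′) v    ≡⟨ balanced-sum bal (λ a → ⌊ head D a ≟ᶠ v ⌋) ⟩
        deg (lookup B₁) v + deg (lookup B₂) v   ≡⟨ total v ⟨
        k₁ v + k₂ v                             ∎)
        where open ≡-Reasoning
      lo′ : (M₂ ⋎ C) ⊑ lookup R′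
      lo′ a eq rewrite lookup∘tabulate (λ a → (U a ∧ not (lookup R a)) ∨ C a) a
        with lookup R a in r
      ... | false = U∨C (M⋎C⊑U M₂⊑F a eq)
        where
        U∨C : U a ≡ true → (U a ∧ true) ∨ C a ≡ true
        U∨C Ua = ⋎-inj₁ (λ a → U a ∧ true) C a (∧-true Ua refl)
      ... | true = ⋎-inj₂ (λ a → U a ∧ false) C a (only-C (not-true (proj₂ (true∧ {U a} (hi a r)))) eq)
        where
        only-C : M₂ a ≡ false → (M₂ ⋎ C) a ≡ true → C a ≡ true
        only-C M₂a eq = subst (λ x → x ∨ C a ≡ true) M₂a eq

  minimal-subset : ∀ {P : Subset n → Set} → (∀ X → Dec (P X)) → ∀ X → Acc _<_ ∣ X ∣ → P X →
                   ∃[ Y ] (P Y × (∀ Z → P Z → ¬ ∣ Z ∣ < ∣ Y ∣))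
  minimal-subset P? X (acc rs) PX with anySubset? (λ Z → P? Z ×-dec ∣ Z ∣ <? ∣ X ∣)
  ... | yes (Z , PZ , Z<X) = minimal-subset P? Z (rs Z<X) PZ
  ... | no  none           = X , PX , λ Z PZ Z<X → none (Z , PZ , Z<X)

  -- Moving one unit of indegree

  unit : Fin n → Fin n → ℕ
  unit u v = [ ⌊ u ≟ᶠ v ⌋ ]

  unit-diag : ∀ u → unit u u ≡ 1
  unit-diag u with u ≟ᶠ u
  ... | yes _  = refl
  ... | no u≢u = contradiction refl u≢u

  unit-off : ∀ {u v} → u ≢ v → unit u v ≡ 0
  unit-off {u} {v} u≢v with u ≟ᶠ v
  ... | yes u≡v = contradiction u≡v u≢v
  ... | no  _   = refl

  module ExchangeAt {B₁ B₂ : Subset m} (br₁ : IsBBranching D b B₁) (br₂ : IsBBranching D b B₂)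
           (u : Fin n) (d₁u<d₂u : indeg D B₁ u < indeg D B₂ u) where

    d₁ = indeg D B₁
    d₂ = indeg D B₂
    C = common B₁ B₂
    F = symDiff B₁ B₂
    -- The truncated subtraction is exact: `d₁u<d₂u` makes `d₂ u` positive.
    k₁ k₂ : Fin n → ℕ
    k₁ z = unit u z + d₁ z
    k₂ z = d₂ z ∸ unit u z

    k₁-off : ∀ {z} → u ≢ z → k₁ z ≡ d₁ z
    k₁-off {z} u≢z = cong (_+ d₁ z) (unit-off u≢z)

    k₂-off : ∀ {z} → u ≢ z → k₂ z ≡ d₂ z
    k₂-off {z} u≢z = cong (d₂ z ∸_) (unit-off u≢z)

    suc-k₂u : suc (k₂ u) ≡ d₂ u
    suc-k₂u = trans (cong (λ c → suc (d₂ u ∸ c)) (unit-diag u)) (m+[n∸m]≡n (≤-trans (s≤s z≤n) d₁u<d₂u))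

    k₁≤b : ∀ z → k₁ z ≤ b z
    k₁≤b z with u ≟ᶠ z
    ... | yes refl = ≤-trans d₁u<d₂u (proj₁ br₂ z)
    ... | no  _    = proj₁ br₁ z

    k₂≤b : ∀ z → k₂ z ≤ b z
    k₂≤b z = ≤-trans (m∸n≤m (d₂ z) (unit u z)) (proj₁ br₂ z)

    total : ∀ z → k₁ z + k₂ z ≡ d₁ z + d₂ z
    total z = trans (shuffle (unit u z) (d₁ z) (k₂ z)) (cong (d₁ z +_) (m+[n∸m]≡n unit≤))
      where
      shuffle : ∀ p q r → (p + q) + r ≡ q + (p + r)
      shuffle = solve-∀
      unit≤ : unit u z ≤ d₂ z
      unit≤ with u ≟ᶠ z
      ... | yes refl = ≤-trans (s≤s z≤n) d₁u<d₂u
      ... | no  _    = z≤n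

    C≤d₁ : ∀ z → deg C z ≤ d₁ z
    C≤d₁ z = deg-mono C (lookup B₁) z λ a eq → proj₁ (true∧ eq)

    C≤d₂ : ∀ z → deg C z ≤ d₂ z
    C≤d₂ z = deg-mono C (lookup B₂) z λ a eq → proj₂ (true∧ {lookup B₁ a} eq)

    C≤k₁ : ∀ z → deg C z ≤ k₁ z
    C≤k₁ z = ≤-trans (C≤d₁ z) (m≤n+m (d₁ z) (unit u z))

    C≤k₂ : ∀ z → deg C z ≤ k₂ z
    C≤k₂ z = m+n≤o⇒m≤o∸n (deg C z) bound
      where
      bound : deg C z + unit u z ≤ d₂ z
      bound with u ≟ᶠ z
      ... | yes refl = subst (_≤ d₂ u) (+-comm 1 _) (≤-trans (s≤s (C≤d₁ u)) d₁u<d₂u)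
      ... | no  _    = subst (_≤ d₂ z) (sym (+-identityʳ _)) (C≤d₂ z)

    covers₁ : ∀ X → Nonempty X → (∀ v → v ∈ X → d₁ v ≡ b v) → 1 ≤ ρ (lookup B₁) X
    covers₁ X ne eq = branching⇒covers {B₁} br₁ X ne λ {v} v∈X → ∈full⁺ {d₁} (eq v v∈X)

    covers₂ : ∀ X → Nonempty X → (∀ v → v ∈ X → d₂ v ≡ b v) → 1 ≤ ρ (lookup B₂) X
    covers₂ X ne eq = branching⇒covers {B₂} br₂ X ne λ {v} v∈X → ∈full⁺ {d₂} (eq v v∈X)

    -- Away from `u` the vectors `k₁` and `k₂` agree with the old indegrees, so `B₁` and `B₂`
    -- themselves meet all demands of sets omitting `u`. No set in `full k₂` contains `u`, because
    -- `k₂ u < b u`. What can fail is the demand of the first part at a set containing `u`.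
    record Blocking (X : Subset n) : Set where
      constructor blocking
      field
        u∈   : u ∈ X
        ⊆S   : X ⊆ full k₁
        C≡0  : ρ C X ≡ 0
        F≡0  : ρ F X ≡ 0

    blocking? : ∀ X → Dec (Blocking X)
    blocking? X = map′ (λ (p , q , r , s) → blocking p q r s)
                       (λ (blocking p q r s) → p , (λ {v} → q {v}) , r , s)
                       (u ∈? X ×-dec X ⊆? full k₁ ×-dec ρ C X ≟ 0 ×-dec ρ F X ≟ 0)

    B₁+B₂≤F : ∀ X → ρ C X ≡ 0 → ρ (lookup B₁) X + ρ (lookup B₂) X ≤ ρ F X
    B₁+B₂≤F X C0 = ≤-reflexive (ρ-symDiff B₁ B₂ X C0)

    B₁≤F : ∀ X → ρ C X ≡ 0 → ρ (lookup B₁) X ≤ ρ F X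
    B₁≤F X C0 = ≤-trans (m≤m+n _ _) (B₁+B₂≤F X C0)

    B₂≤F : ∀ X → ρ C X ≡ 0 → ρ (lookup B₂) X ≤ ρ F X
    B₂≤F X C0 = ≤-trans (m≤n+m _ _) (B₁+B₂≤F X C0)

    k₂u≢b : k₂ u ≢ b u
    k₂u≢b eq = <-irrefl eq (subst (_≤ b u) (sym suc-k₂u) (proj₁ br₂ u))

    avoid : ∀ {X : Subset n} {z v} → z ∈ X → v ∉ X → v ≢ z
    avoid z∈X v∉X refl = v∉X z∈X

    direct : ¬ ∃ Blocking → Coverable F C (full k₁) (full k₂)
    direct none-blocking = record
      { demandT = demandT
      ; demandS = λ X ne C0 X⊆ → ≤-trans (covers₂ X ne (d₂-full X⊆)) (B₂≤F X C0)
      ; demand₂ = λ X ne C0 X⊆₁ X⊆₂ → ≤-trans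
          (+-mono-≤ (covers₁ X ne (d₁-full X⊆₁ (u∉ X⊆₂))) (covers₂ X ne (d₂-full X⊆₂))) (B₁+B₂≤F X C0) }
      where
      d₁-full : ∀ {X} → X ⊆ full k₁ → u ∉ X → ∀ v → v ∈ X → d₁ v ≡ b v
      d₁-full X⊆ u∉X v v∈X = trans (sym (k₁-off (avoid v∈X u∉X))) (∈full⁻ {k₁} (X⊆ v∈X))
      u∉ : ∀ {X} → X ⊆ full k₂ → u ∉ X
      u∉ X⊆ u∈X = k₂u≢b (∈full⁻ {k₂} (X⊆ u∈X))
      d₂-full : ∀ {X} → X ⊆ full k₂ → ∀ v → v ∈ X → d₂ v ≡ b v
      d₂-full X⊆ v v∈X = trans (sym (k₂-off (avoid v∈X (u∉ X⊆)))) (∈full⁻ {k₂} (X⊆ v∈X))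
      demandT : ∀ X → Nonempty X → ρ C X ≡ 0 → X ⊆ full k₁ → 1 ≤ ρ F X
      demandT X ne C0 X⊆ with u ∈? X | ρ F X ≟ 0
      ... | no u∉X  | _       = ≤-trans (covers₁ X ne (d₁-full X⊆ u∉X)) (B₁≤F X C0)
      ... | yes _   | no F≢0  = n≢0⇒n>0 F≢0
      ... | yes u∈X | yes F≡0 = contradiction (X , blocking u∈X X⊆ C0 F≡0) none-blocking

    module Blocked {X₀} (bl : Blocking X₀) (minimal : ∀ Z → Blocking Z → ¬ ∣ Z ∣ < ∣ X₀ ∣)
                   (v : Fin n) (v∈X₀ : v ∈ X₀) (d₂v≢b : d₂ v ≢ b v) where
      open Blocking bl

      -- `u` lies in `full k₁`, so `b u = d₁ u + 1 ≤ d₂ u`: the second branching is full at `u`, but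
      -- not at `v`.
      u≢v : u ≢ v
      u≢v refl = d₂v≢b (≤-antisym (proj₁ br₂ u) (begin
        b u         ≡⟨ ∈full⁻ {k₁} (⊆S u∈) ⟨
        k₁ u        ≡⟨ cong (_+ d₁ u) (unit-diag u) ⟩
        suc (d₁ u)  ≤⟨ d₁u<d₂u ⟩
        d₂ u        ∎))
        where open ≤-Reasoning

      d₁v≡b : d₁ v ≡ b v
      d₁v≡b = trans (sym (k₁-off u≢v)) (∈full⁻ {k₁} (⊆S v∈X₀))

      d₂v<b : d₂ v < b v
      d₂v<b = ≤∧≢⇒< (proj₁ br₂ v) d₂v≢b

      -- This allows `B₁` to give up a unit at `v`: the common arcs still fit (`C≤l₁`), and at least
      -- `d₂ v` remains.
      d₂v<d₁v : d₂ v < d₁ v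
      d₂v<d₁v = subst (d₂ v <_) (sym d₁v≡b) d₂v<b

      l₁ l₂ : Fin n → ℕ
      l₁ z = k₁ z ∸ unit v z
      l₂ z = unit v z + k₂ z

      l₁-off : ∀ {z} → v ≢ z → l₁ z ≡ k₁ z
      l₁-off {z} v≢z = cong (k₁ z ∸_) (unit-off v≢z)

      l₂-off : ∀ {z} → v ≢ z → l₂ z ≡ k₂ z
      l₂-off {z} v≢z = cong (_+ k₂ z) (unit-off v≢z)

      unit≤k₁ : ∀ z → unit v z ≤ k₁ z
      unit≤k₁ z with v ≟ᶠ z
      ... | yes refl = ≤-trans (≤-trans (s≤s z≤n) d₂v<d₁v) (m≤n+m (d₁ z) (unit u z))
      ... | no  _    = z≤n

      total′ : ∀ z → l₁ z + l₂ z ≡ d₁ z + d₂ z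
      total′ z = trans (sym (+-assoc (l₁ z) (unit v z) (k₂ z)))
                       (trans (cong (_+ k₂ z) (m∸n+n≡m (unit≤k₁ z))) (total z))

      l₁≤b : ∀ z → l₁ z ≤ b z
      l₁≤b z = ≤-trans (m∸n≤m (k₁ z) (unit v z)) (k₁≤b z)

      l₂≤b : ∀ z → l₂ z ≤ b z
      l₂≤b z with v ≟ᶠ z
      ... | yes refl = ≤-trans (s≤s (m∸n≤m (d₂ v) (unit u v))) d₂v<b
      ... | no  _    = k₂≤b z

      C≤l₁ : ∀ z → deg C z ≤ l₁ z
      C≤l₁ z = m+n≤o⇒m≤o∸n (deg C z) bound
        where
        bound : deg C z + unit v z ≤ k₁ z
        bound with v ≟ᶠ z
        ... | yes refl = subst (_≤ k₁ v) (+-comm 1 _)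
                (≤-trans (s≤s (C≤d₂ v)) (≤-trans d₂v<d₁v (m≤n+m (d₁ v) (unit u v))))
        ... | no  _    = subst (_≤ k₁ z) (sym (+-identityʳ _)) (C≤k₁ z)

      C≤l₂ : ∀ z → deg C z ≤ l₂ z
      C≤l₂ z = ≤-trans (C≤k₂ z) (m≤n+m (k₂ z) (unit v z))

      v∉ : ∀ {X} → X ⊆ full l₁ → v ∉ X
      v∉ X⊆ v∈X = <-irrefl (∈full⁻ {l₁} (X⊆ v∈X)) (begin-strict
        l₁ v        ≡⟨ cong₂ _∸_ (k₁-off u≢v) (unit-diag v) ⟩
        d₁ v ∸ 1    <⟨ ∸-monoʳ-< (s≤s z≤n) (≤-trans (s≤s z≤n) d₂v<d₁v) ⟩
        d₁ v        ≡⟨ d₁v≡b ⟩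
        b v         ∎)
        where open ≤-Reasoning

      u∉ : ∀ {X} → X ⊆ full l₂ → u ∉ X
      u∉ X⊆ u∈X = k₂u≢b (trans (sym (l₂-off (u≢v ∘ sym))) (∈full⁻ {l₂} (X⊆ u∈X)))

      k₁-full : ∀ {X} → X ⊆ full l₁ → X ⊆ full k₁
      k₁-full X⊆ z∈X = ∈full⁺ {k₁} (trans (sym (l₁-off (avoid z∈X (v∉ X⊆)))) (∈full⁻ {l₁} (X⊆ z∈X)))

      d₁-full : ∀ {X} → X ⊆ full k₁ → u ∉ X → ∀ z → z ∈ X → d₁ z ≡ b z
      d₁-full X⊆ u∉X z z∈X = trans (sym (k₁-off (avoid z∈X u∉X))) (∈full⁻ {k₁} (X⊆ z∈X))

      d₂-full : ∀ {X} → X ⊆ full l₂ → v ∉ X → ∀ z → z ∈ X → d₂ z ≡ b z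
      d₂-full X⊆ v∉X z z∈X = trans
        (sym (trans (l₂-off (avoid z∈X v∉X)) (k₂-off (avoid z∈X (u∉ X⊆))))) (∈full⁻ {l₂} (X⊆ z∈X))

      demandT : ∀ X → Nonempty X → ρ C X ≡ 0 → X ⊆ full l₁ → 1 ≤ ρ F X
      demandT X ne C0 X⊆ with u ∈? X | ρ F X ≟ 0
      ... | no u∉X  | _       = ≤-trans (covers₁ X ne (d₁-full (k₁-full X⊆) u∉X)) (B₁≤F X C0)
      ... | yes _   | no F≢0  = n≢0⇒n>0 F≢0
      -- `X` omits `v`, since `l₁ v < b v`. So `X ∩ X₀` would be a blocking set strictly inside the
      -- minimal one.
      ... | yes u∈X | yes F0  = contradiction smaller
        (minimal (X ∩ X₀) (blocking (x∈p∩q⁺ (u∈X , u∈)) (⊆S ∘ p∩q⊆q X X₀)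
                            (ρ-∩≡0 C X X₀ C0 C≡0) (ρ-∩≡0 F X X₀ F0 F≡0)))
        where
        smaller : ∣ X ∩ X₀ ∣ < ∣ X₀ ∣
        smaller = p⊂q⇒∣p∣<∣q∣ (p∩q⊆q X X₀ , v , v∈X₀ , v∉ X⊆ ∘ p∩q⊆p X X₀)

      demandS : ∀ X → Nonempty X → ρ C X ≡ 0 → X ⊆ full l₂ → 1 ≤ ρ F X
      demandS X ne C0 X⊆ with v ∈? X | ρ F X ≟ 0
      ... | no v∉X  | _       = ≤-trans (covers₂ X ne (d₂-full X⊆ v∉X)) (B₂≤F X C0)
      ... | yes _   | no F≢0  = n≢0⇒n>0 F≢0
      -- `X ∩ X₀` contains `v` but not `u`, and `B₁` is full on it. Hence `B₁` enters it, although
      -- neither `C` nor `F` does.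
      ... | yes v∈X | yes F0  = contradiction (begin
        1                        ≤⟨ covers₁ (X ∩ X₀) (v , x∈p∩q⁺ (v∈X , v∈X₀))
                                      (d₁-full (⊆S ∘ p∩q⊆q X X₀) (u∉ X⊆ ∘ p∩q⊆p X X₀)) ⟩
        ρ (lookup B₁) (X ∩ X₀)   ≤⟨ B₁≤F (X ∩ X₀) (ρ-∩≡0 C X X₀ C0 C≡0) ⟩
        ρ F (X ∩ X₀)             ≡⟨ ρ-∩≡0 F X X₀ F0 F≡0 ⟩
        0                        ∎) λ ()
        where open ≤-Reasoning

      swapped : Resplit B₁ B₂ l₁ l₂
      swapped = Resplitting.resplit B₁ B₂ l₁ l₂ total′ l₁≤b l₂≤b C≤l₁ C≤l₂ record
        { demandT = demandT
        ; demandS = demandS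
        -- A set in both full sets avoids `u` and `v`, so each old branching supplies one arc.
        ; demand₂ = λ X ne C0 X⊆₁ X⊆₂ → ≤-trans
            (+-mono-≤ (covers₁ X ne (d₁-full (k₁-full X⊆₁) (u∉ X⊆₂)))
                      (covers₂ X ne (d₂-full X⊆₂ (v∉ X⊆₁)))) (B₁+B₂≤F X C0) }

    exchange : Resplit B₁ B₂ (λ z → unit u z + indeg D B₁ z) (λ z → indeg D B₂ z ∸ unit u z)
      ⊎ ∃[ v ] (u ≢ v × indeg D B₂ v < indeg D B₁ v ×
                Resplit B₁ B₂ (λ z → (unit u z + indeg D B₁ z) ∸ unit v z)
                              (λ z → unit v z + (indeg D B₂ z ∸ unit u z)))
    exchange with anySubset? blocking?
    ... | no  none-blocking = inj₁ (Resplitting.resplit B₁ B₂ k₁ k₂ total k₁≤b k₂≤b C≤k₁ C≤k₂ (direct none-blocking))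
    ... | yes (X , bX) with minimal-subset blocking? X (<-wellFounded _) bX
    ...   | X₀ , bl , minimal with any? (λ v → v ∈? X₀ ×-dec ¬? (d₂ v ≟ b v))
    ...     | yes (v , v∈X₀ , d₂v≢b) = inj₂ (v , u≢v , d₂v<d₁v , swapped)
      where open Blocked bl minimal v v∈X₀ d₂v≢b
    -- If `B₂` were full on all of `X₀`, it would enter `X₀`, which no arc of `F` or `C` does.
    ...     | no  none-v = contradiction
      (≤-trans (covers₂ X₀ (u , u∈) λ v v∈ → decidable-stable (d₂ v ≟ b v) λ ne → none-v (v , v∈ , ne))
        (≤-trans (B₂≤F X₀ C≡0) (≤-reflexive F≡0))) λ ()
      where open Blocking bl

-- Convexity of the minimum cost

module Decidability {n m : ℕ} (D : Digraph n m) (b : Fin n → ℕ) where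

  branching? : ∀ B → Dec (IsBBranching D b B)
  branching? B = all? (λ v → indeg D B v ≤? b v) ×-dec
    map′ (λ none X ne → decidable-stable (sparse? X) λ dense → none (X , ne , dense))
         (λ sparse (X , ne , dense) → dense (sparse X ne))
         (¬? (anySubset? (λ X → nonempty? X ×-dec ¬? (sparse? X))))
    where
    sparse? : ∀ X → Dec (arcsIn D B X + 1 ≤ bSum D b X)
    sparse? X = arcsIn D B X + 1 ≤? bSum D b X

  -- Being in the domain is a finite search, which makes the case distinction of the theorem
  -- constructive.
  inDom? : ∀ x → Dec (InDom D b x)
  inDom? x = all? (λ v → ℤ.+ 0 ℤ.≤? x v) ×-dec
    anySubset? (λ B → branching? B ×-dec all? (λ v → ℤ.+ b v ℤ.≤? ℤ.+ indeg D B v ℤ.+ x v))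

m≤m∸n+n : ∀ m n → m ≤ (m ∸ n) + n
m≤m∸n+n m n = subst (m ≤_) (+-comm n (m ∸ n)) (m≤n+m∸n m n)

module _ where
  open import Data.Integer using (+_)

  -- The constraint sees only the sum of indegree and `x`: a decrease of `x` is paid for in
  -- indegree. `shift⁺` is the opposite trade.
  shift⁻ : ∀ {b d} k p x → + b ℤ.≤ + d ℤ.+ x → d + p ≤ k → + b ℤ.≤ + k ℤ.+ (x ℤ.- + p)
  shift⁻ {b} {d} k p x b≤ d+p≤k = begin
    + b                          ≤⟨ b≤ ⟩
    + d ℤ.+ x                    ≡⟨ regroup (+ d) (+ p) x ⟩
    (+ d ℤ.+ + p) ℤ.+ (x ℤ.- + p)  ≤⟨ ℤₚ.+-monoˡ-≤ (x ℤ.- + p) (ℤ.+≤+ d+p≤k) ⟩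
    + k ℤ.+ (x ℤ.- + p)          ∎
    where
    open ℤₚ.≤-Reasoning
    regroup : ∀ d p x → d ℤ.+ x ≡ (d ℤ.+ p) ℤ.+ (x ℤ.- p)
    regroup = ℤ-Solver.solve-∀

  shift⁺ : ∀ {b d} k p x → + b ℤ.≤ + d ℤ.+ x → d ≤ k + p → + b ℤ.≤ + k ℤ.+ (x ℤ.+ + p)
  shift⁺ {b} {d} k p x b≤ d≤k+p = begin
    + b                    ≤⟨ b≤ ⟩
    + d ℤ.+ x              ≤⟨ ℤₚ.+-monoˡ-≤ x (ℤ.+≤+ d≤k+p) ⟩
    (+ k ℤ.+ + p) ℤ.+ x    ≡⟨ regroup (+ k) (+ p) x ⟩
    + k ℤ.+ (x ℤ.+ + p)    ∎
    where
    open ℤₚ.≤-Reasoning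
    regroup : ∀ k p x → (k ℤ.+ p) ℤ.+ x ≡ k ℤ.+ (x ℤ.+ p)
    regroup = ℤ-Solver.solve-∀

  <⇒≤-1 : ∀ {i j} → i ℤ.< j → i ℤ.≤ j ℤ.- + 1
  <⇒≤-1 {i} {j} i<j = subst (i ℤ.≤_) (ℤₚ.+-comm ℤ.-1ℤ j) (ℤₚ.i<j⇒i≤pred[j] i<j)

module _ {c ℓ₁ ℓ₂} (G : OrderedAbelianGroup c ℓ₁ ℓ₂) where
  open OrderedAbelianGroup G hiding (_≤_; refl; sym; trans)
  open OrderedAbelianGroup G using () renaming (_≤_ to _≤ᴳ_; refl to ≈-refl; sym to ≈-sym; trans to ≈-trans)
  open IsTotalOrder isTotalOrder using () renaming (trans to ≤ᴳ-trans; reflexive to ≤ᴳ-reflexive)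
  open Weighted G

  ∙-mono-≤ᴳ : ∀ {p q r s} → p ≤ᴳ q → r ≤ᴳ s → (p ∙ r) ≤ᴳ (q ∙ s)
  ∙-mono-≤ᴳ {p} {q} {r} {s} p≤q r≤s = ≤ᴳ-trans (∙-monoˡ-≤ r p≤q)
    (≤ᴳ-trans (≤ᴳ-reflexive (comm q r)) (≤ᴳ-trans (∙-monoˡ-≤ q r≤s) (≤ᴳ-reflexive (comm s q))))

  sumG-∙ : ∀ k (f h : Fin k → Carrier) → (sumG k f ∙ sumG k h) ≈ sumG k (λ i → f i ∙ h i)
  sumG-∙ zero    f h = identityˡ ε
  sumG-∙ (suc k) f h = begin
    (f zero ∙ F) ∙ (h zero ∙ H)  ≈⟨ assoc (f zero) F _ ⟩
    f zero ∙ (F ∙ (h zero ∙ H))  ≈⟨ ∙-congˡ (assoc F (h zero) H) ⟨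
    f zero ∙ ((F ∙ h zero) ∙ H)  ≈⟨ ∙-congˡ (∙-congʳ (comm F (h zero))) ⟩
    f zero ∙ ((h zero ∙ F) ∙ H)  ≈⟨ ∙-congˡ (assoc (h zero) F H) ⟩
    f zero ∙ (h zero ∙ (F ∙ H))  ≈⟨ assoc (f zero) (h zero) _ ⟨
    (f zero ∙ h zero) ∙ (F ∙ H)  ≈⟨ ∙-congˡ (sumG-∙ k (f ∘ suc) (h ∘ suc)) ⟩
    (f zero ∙ h zero) ∙ sumG k (λ i → f (suc i) ∙ h (suc i)) ∎
    where
    open SetoidReasoning setoid
    F = sumG k (f ∘ suc)
    H = sumG k (h ∘ suc)

  sumG-cong : ∀ k {f h : Fin k → Carrier} → (∀ i → f i ≈ h i) → sumG k f ≈ sumG k h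
  sumG-cong zero    f≈h = ≈-refl
  sumG-cong (suc k) f≈h = ∙-cong (f≈h zero) (sumG-cong k (f≈h ∘ suc))

  -- Writing the weight of a pair through arc multiplicities shows that it depends only on the
  -- multiset of arcs.
  multiple : ℕ → Carrier → Carrier
  multiple zero    z = ε
  multiple (suc k) z = z ∙ multiple k z

  pair-multiple : ∀ p q z → ((if p then z else ε) ∙ (if q then z else ε)) ≈ multiple ([ p ] + [ q ]) z
  pair-multiple true  true  z = ∙-congˡ (≈-sym (identityʳ z))
  pair-multiple true  false z = ≈-refl
  pair-multiple false true  z = comm ε z
  pair-multiple false false z = identityˡ ε

  weight-pair : ∀ {m} (w : Fin m → Carrier) B₁ B₂ →
    (weight w B₁ ∙ weight w B₂) ≈ sumG m (λ a → multiple ([ lookup B₁ a ] + [ lookup B₂ a ]) (w a))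
  weight-pair {m} w B₁ B₂ = ≈-trans (sumG-∙ m _ _)
    (sumG-cong m (λ a → pair-multiple (lookup B₁ a) (lookup B₂ a) (w a)))

  weight-balanced : ∀ {m} (w : Fin m → Carrier) B₁ B₂ B₁′ B₂′ →
    (∀ a → [ lookup B₁′ a ] + [ lookup B₂′ a ] ≡ [ lookup B₁ a ] + [ lookup B₂ a ]) →
    (weight w B₁′ ∙ weight w B₂′) ≈ (weight w B₁ ∙ weight w B₂)
  weight-balanced {m} w B₁ B₂ B₁′ B₂′ bal = ≈-trans (weight-pair w B₁′ B₂′) (≈-trans
    (sumG-cong m (λ a → reflexive (cong (λ k → multiple k (w a)) (bal a)))) (≈-sym (weight-pair w B₁ B₂)))

module MinCost {c ℓ₁ ℓ₂} (G : OrderedAbelianGroup c ℓ₁ ℓ₂) {n m : ℕ} (D : Digraph n m)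
  (b : Fin n → ℕ) (w : Fin m → OrderedAbelianGroup.Carrier G)
  (g : (Fin n → ℤ) → Weighted.Ext G) (isMin : Weighted.IsMinBranchingCost G D b w g) where
  open OrderedAbelianGroup G using (isTotalOrder) renaming (_≤_ to _≤ᴳ_)
  open IsTotalOrder isTotalOrder using () renaming (trans to ≤ᴳ-trans; reflexive to ≤ᴳ-reflexive)
  open Weighted G
  open Exchange D b
  open Decidability D b
  open import Data.Integer using (+_)

  χ≡unit : ∀ (u z : Fin n) → χ u z ≡ + unit u z
  χ≡unit u z with u ≟ᶠ z
  ... | yes _ = refl
  ... | no  _ = refl

  χ≥0 : ∀ (u z : Fin n) → + 0 ℤ.≤ χ u z
  χ≥0 u z = subst (+ 0 ℤ.≤_) (sym (χ≡unit u z)) (ℤ.+≤+ z≤n)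

  plus-χ≥0 : ∀ {x : Fin n → ℤ} u → (∀ z → + 0 ℤ.≤ x z) → ∀ z → + 0 ℤ.≤ x z ℤ.+ χ u z
  plus-χ≥0 u x≥0 z = ℤₚ.+-mono-≤ (x≥0 z) (χ≥0 u z)

  minus-χ≥0 : ∀ {x : Fin n → ℤ} u → (∀ z → + 0 ℤ.≤ x z) → + 0 ℤ.< x u → ∀ z → + 0 ℤ.≤ x z ℤ.- χ u z
  minus-χ≥0 {x} u x≥0 x>0 z with u ≟ᶠ z
  ... | yes refl = <⇒≤-1 x>0
  ... | no  _    = subst (+ 0 ℤ.≤_) (sym (ℤₚ.+-identityʳ (x z))) (x≥0 z)

  Cheaper : (x y x′ y′ : Fin n → ℤ) → Set _
  Cheaper x y x′ y′ = (g x′ ⊕ g y′) ≤∞ (g x ⊕ g y)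

  Convex : (x y : Fin n → ℤ) (u : Fin n) → Set _
  Convex x y u =
    Cheaper x y (λ i → x i ℤ.- χ u i) (λ i → y i ℤ.+ χ u i)
    ⊎ (∃[ v ] (x v ℤ.< y v ×
        Cheaper x y (λ i → (x i ℤ.- χ u i) ℤ.+ χ v i) (λ i → (y i ℤ.+ χ u i) ℤ.- χ v i)))

  module InDomain (x y : Fin n → ℤ) (u : Fin n) (yu<xu : y u ℤ.< x u)
    (x≥0 : ∀ z → + 0 ℤ.≤ x z) (y≥0 : ∀ z → + 0 ℤ.≤ y z) (B₁ B₂ : Subset m)
    (feas₁ : Feasible D b x B₁) (feas₂ : Feasible D b y B₂)
    (gx : g x ≡ fin (weight w B₁)) (gy : g y ≡ fin (weight w B₂)) where

    d₁ = indeg D B₁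
    d₂ = indeg D B₂

    -- The new pair is feasible, so its weight bounds the values of `g` at the new points from
    -- above; by `bal` this weight is the optimal one of the old points.
    cheaper : ∀ x′ y′ B₁′ B₂′ → (∀ z → + 0 ℤ.≤ x′ z) → (∀ z → + 0 ℤ.≤ y′ z) →
      Feasible D b x′ B₁′ → Feasible D b y′ B₂′ →
      Balanced (lookup B₁′) (lookup B₂′) (lookup B₁) (lookup B₂) → Cheaper x y x′ y′
    cheaper x′ y′ B₁′ B₂′ x′≥0 y′≥0 f₁ f₂ bal
      with proj₂ (isMin x′) (x′≥0 , B₁′ , f₁) | proj₂ (isMin y′) (y′≥0 , B₂′ , f₂)
    ... | A₁ , _ , gx′ , min₁ | A₂ , _ , gy′ , min₂ =
      subst₂ _≤∞_ (sym (cong₂ _⊕_ gx′ gy′)) (sym (cong₂ _⊕_ gx gy))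
        (fin≤fin (≤ᴳ-trans (∙-mono-≤ᴳ G (min₁ B₁′ f₁) (min₂ B₂′ f₂))
                           (≤ᴳ-reflexive (weight-balanced G w B₁ B₂ B₁′ B₂′ bal))))

    x-χu≥0 : ∀ z → + 0 ℤ.≤ x z ℤ.- χ u z
    x-χu≥0 = minus-χ≥0 u x≥0 (ℤₚ.≤-<-trans (y≥0 u) yu<xu)

    y+χu≥0 : ∀ z → + 0 ℤ.≤ y z ℤ.+ χ u z
    y+χu≥0 = plus-χ≥0 u y≥0

    minus-u : ∀ z k → d₁ z + unit u z ≤ k → + b z ℤ.≤ + k ℤ.+ (x z ℤ.- χ u z)
    minus-u z k le = subst (λ e → + b z ℤ.≤ + k ℤ.+ (x z ℤ.- e)) (sym (χ≡unit u z))
      (shift⁻ k (unit u z) (x z) (proj₂ feas₁ z) le)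

    plus-u : ∀ z k → d₂ z ≤ k + unit u z → + b z ℤ.≤ + k ℤ.+ (y z ℤ.+ χ u z)
    plus-u z k le = subst (λ e → + b z ℤ.≤ + k ℤ.+ (y z ℤ.+ e)) (sym (χ≡unit u z))
      (shift⁺ k (unit u z) (y z) (proj₂ feas₂ z) le)

    cheaper₁ : ∀ B₁′ B₂′ → IsBBranching D b B₁′ → IsBBranching D b B₂′ →
      (∀ z → + b z ℤ.≤ + indeg D B₁′ z ℤ.+ (x z ℤ.- χ u z)) →
      (∀ z → + b z ℤ.≤ + indeg D B₂′ z ℤ.+ (y z ℤ.+ χ u z)) →
      Balanced (lookup B₁′) (lookup B₂′) (lookup B₁) (lookup B₂) → Convex x y u
    cheaper₁ B₁′ B₂′ br₁ br₂ at-x at-y bal =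
      inj₁ (cheaper _ _ B₁′ B₂′ x-χu≥0 y+χu≥0 (br₁ , at-x) (br₂ , at-y) bal)

    unshifted : d₂ u ≤ d₁ u → Convex x y u
    unshifted d₂≤d₁ = cheaper₁ B₁ B₂ (proj₁ feas₁) (proj₁ feas₂) at-x
      (λ z → plus-u z (d₂ z) (m≤m+n _ _)) (λ _ → refl)
      where
      at-x : ∀ z → + b z ℤ.≤ + d₁ z ℤ.+ (x z ℤ.- χ u z)
      at-x z with u ≟ᶠ z
      -- At `u` the constraint is inherited from `B₂` and `y`: `d₂ u ≤ d₁ u` and `y u ≤ x u - 1`.
      ... | yes refl = ℤₚ.≤-trans (proj₂ feas₂ u) (ℤₚ.+-mono-≤ (ℤ.+≤+ d₂≤d₁) (<⇒≤-1 yu<xu))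
      ... | no  _    = shift⁻ (d₁ z) 0 (x z) (proj₂ feas₁ z) (≤-reflexive (+-identityʳ _))

    moved : Resplit B₁ B₂ (λ z → unit u z + d₁ z) (λ z → d₂ z ∸ unit u z) → Convex x y u
    moved R = cheaper₁ B₁′ B₂′ branching₁ branching₂
      (λ z → minus-u z _ (≤-reflexive (trans (+-comm (d₁ z) _) (sym (indeg₁ z)))))
      (λ z → plus-u z _ (subst (λ k → d₂ z ≤ k + unit u z) (sym (indeg₂ z)) (m≤m∸n+n (d₂ z) (unit u z))))
      balanced
      where open Resplit R

    swapped : ∀ v → u ≢ v → d₂ v < d₁ v →
      Resplit B₁ B₂ (λ z → (unit u z + d₁ z) ∸ unit v z) (λ z → unit v z + (d₂ z ∸ unit u z)) →
      Convex x y u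
    swapped v u≢v d₂v<d₁v R with x v ℤ.<? y v
    ... | yes xv<yv = inj₂ (v , xv<yv , cheaper _ _ B₁′ B₂′ (plus-χ≥0 v x-χu≥0)
        (minus-χ≥0 v y+χu≥0 yv′>0) (branching₁ , at-x) (branching₂ , at-y) balanced)
      where
      open Resplit R
      yv′>0 : + 0 ℤ.< y v ℤ.+ χ u v
      yv′>0 = ℤₚ.+-mono-<-≤ (ℤₚ.≤-<-trans (x≥0 v) xv<yv) (χ≥0 u v)
      at-x : ∀ z → + b z ℤ.≤ + indeg D B₁′ z ℤ.+ ((x z ℤ.- χ u z) ℤ.+ χ v z)
      at-x z = subst₂ (λ k e → + b z ℤ.≤ + k ℤ.+ ((x z ℤ.- χ u z) ℤ.+ e)) (sym (indeg₁ z)) (sym (χ≡unit v z))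
        (shift⁺ _ (unit v z) (x z ℤ.- χ u z)
          (minus-u z (unit u z + d₁ z) (≤-reflexive (+-comm (d₁ z) _)))
          (m≤m∸n+n (unit u z + d₁ z) (unit v z)))
      at-y : ∀ z → + b z ℤ.≤ + indeg D B₂′ z ℤ.+ ((y z ℤ.+ χ u z) ℤ.- χ v z)
      at-y z = subst₂ (λ k e → + b z ℤ.≤ + k ℤ.+ ((y z ℤ.+ χ u z) ℤ.- e)) (sym (indeg₂ z)) (sym (χ≡unit v z))
        (shift⁻ _ (unit v z) (y z ℤ.+ χ u z)
          (plus-u z (d₂ z ∸ unit u z) (m≤m∸n+n (d₂ z) (unit u z)))
          (≤-reflexive (+-comm (d₂ z ∸ unit u z) (unit v z))))
    -- Here `v` may not be used in the exchange, but the first part can afford its loss at `v`: it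
    -- keeps `d₁ v - 1 ≥ d₂ v`, and `x v ≥ y v`, so the constraint of `B₂` for `y` carries over. The
    -- second part only gains at `v`.
    ... | no  xv≮yv = cheaper₁ B₁′ B₂′ branching₁ branching₂ at-x at-y balanced
      where
      open Resplit R
      at-x : ∀ z → + b z ℤ.≤ + indeg D B₁′ z ℤ.+ (x z ℤ.- χ u z)
      at-x z with v ≟ᶠ z | indeg₁ z
      ... | no  _    | eq = minus-u z _ (≤-reflexive (trans (+-comm (d₁ z) _) (sym eq)))
      ... | yes refl | eq rewrite eq | χ≡unit u v | unit-off u≢v =
        ℤₚ.≤-trans (proj₂ feas₂ v) (ℤₚ.+-mono-≤ (ℤ.+≤+ (m+n≤o⇒m≤o∸n (d₂ v) (subst (_≤ d₁ v) (+-comm 1 _) d₂v<d₁v)))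
          (subst (y v ℤ.≤_) (sym (ℤₚ.+-identityʳ (x v))) (ℤₚ.≮⇒≥ xv≮yv)))
      at-y : ∀ z → + b z ℤ.≤ + indeg D B₂′ z ℤ.+ (y z ℤ.+ χ u z)
      at-y z = plus-u z _ (subst (λ k → d₂ z ≤ k + unit u z) (sym (indeg₂ z)) (begin
        d₂ z                                       ≤⟨ m≤m∸n+n (d₂ z) (unit u z) ⟩
        (d₂ z ∸ unit u z) + unit u z               ≤⟨ +-monoˡ-≤ _ (m≤n+m _ (unit v z)) ⟩
        (unit v z + (d₂ z ∸ unit u z)) + unit u z  ∎))
        where open ≤-Reasoning

    convex-inDom : Convex x y u
    convex-inDom with d₁ u <? d₂ u
    ... | no  ≮  = unshifted (≮⇒≥ ≮)
    ... | yes lt with ExchangeAt.exchange {B₁} {B₂} (proj₁ feas₁) (proj₁ feas₂) u lt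
    ...   | inj₁ R                         = moved R
    ...   | inj₂ (v , u≢v , d₂v<d₁v , R)   = swapped v u≢v d₂v<d₁v R

theorem15 : ∀ {c ℓ₁ ℓ₂} (G : OrderedAbelianGroup c ℓ₁ ℓ₂) →
    ∀ (n m : ℕ) (D : Digraph n m) (b : Fin n → ℕ) → (∀ v → 1 ≤ b v) →
    (w : Fin m → OrderedAbelianGroup.Carrier G) →
    (∀ a → OrderedAbelianGroup._≤_ G (OrderedAbelianGroup.ε G) (w a)) →
    (g : (Fin n → ℤ) → Weighted.Ext G) → Weighted.IsMinBranchingCost G D b w g →
    Weighted.MNatConvex G g
theorem15 G n m D b _ w _ g isMin x y u yu<xu = result (inDom? x) (inDom? y)
  where
  open Weighted G
  open Decidability D b
  open MinCost G D b w g isMin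

  ⊕-∞ : ∀ e → e ⊕ ∞ ≡ ∞
  ⊕-∞ (fin _) = refl
  ⊕-∞ ∞       = refl

  ≤∞-top : ∀ {e e′} → e′ ≡ ∞ → e ≤∞ e′
  ≤∞-top refl = _ ≤∞∞

  result : Dec (InDom D b x) → Dec (InDom D b y) → Convex x y u
  result (no x∉) _ = inj₁ (≤∞-top (cong (_⊕ g y) (proj₁ (isMin x) x∉)))
  result _ (no y∉) = inj₁ (≤∞-top (trans (cong (g x ⊕_) (proj₁ (isMin y) y∉)) (⊕-∞ (g x))))
  result (yes x∈) (yes y∈) with proj₂ (isMin x) x∈ | proj₂ (isMin y) y∈
  ... | B₁ , f₁ , gx , _ | B₂ , f₂ , gy , _ =
    InDomain.convex-inDom x y u yu<xu (proj₁ x∈) (proj₁ y∈) B₁ B₂ f₁ f₂ gx gy
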